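{- Let $E(q)=\prod_{k\ge1}(1-q^k)$ and $$X=\frac{E(q^2)^4E(q^3)^8}{E(q)^8E(q^6)^4}.$$ For a formal Laurent series $\sum_{n\ge n_0}a_nq^n$ define $U\left(\sum_{n\ge n_0}a_nq^n\right)=\sum_{3n\ge n_0}a_{3n}q^n$. Then \begin{align*} U(X)&=10X-36X^2+27X^3,\\ U(X^2)&=-8X+306X^2-2160X^3+5508X^4-5832X^5+2187X^6,\\ U(X^3)&=X-360X^2+10566X^3-99144X^4+423549X^5-944784X^6\\ &\qquad+1141614X^7-708588X^8+177147X^9. \end{align*}
   Context: All objects are formal power series in $q$; $X$ has constant term $1$. -}

module Defs where

open import Data.Nat as ℕ using (ℕ; zero; suc; _∸_; _≡ᵇ_; NonZero)
open import Data.Nat.DivMod using (_/_; _%_)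
open import Data.Integer using (ℤ; +_; -_; _+_; _*_)
open import Data.List using (List; []; _∷_)
open import Data.Bool using (if_then_else_)

-- Formal power series in q over ℤ, given by their coefficient sequence.
PS : Set
PS = ℕ → ℤ

sumTo : ℕ → (ℕ → ℤ) → ℤ
sumTo zero    f = f zero
sumTo (suc n) f = sumTo n f + f (suc n)

oneˢ : PS
oneˢ zero    = + 1
oneˢ (suc _) = + 0

_+ˢ_ : PS → PS → PS
(f +ˢ g) n = f n + g n
infixl 6 _+ˢ_

_·ˢ_ : ℤ → PS → PS
(c ·ˢ f) n = c * f n
infixr 7 _·ˢ_

_*ˢ_ : PS → PS → PS
(f *ˢ g) n = sumTo n (λ i → f i * g (n ∸ i))
infixl 7 _*ˢ_

_^ˢ_ : PS → ℕ → PS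
f ^ˢ zero  = oneˢ
f ^ˢ suc k = f *ˢ (f ^ˢ k)
infixr 8 _^ˢ_

-- the polynomial 1 - q^k  (k ≥ 1)
oneMinusQ : ℕ → PS
oneMinusQ k zero    = + 1
oneMinusQ k (suc n) = if suc n ≡ᵇ k then - (+ 1) else + 0

Eprod : ℕ → PS
Eprod zero    = oneˢ
Eprod (suc m) = Eprod m *ˢ oneMinusQ (suc m)

-- E(q) = ∏_{k≥1} (1 - q^k): the coefficient of q^n stabilises once all
-- factors with k ≤ n are included.
E : PS
E n = Eprod n n

dil : (k : ℕ) → .{{NonZero k}} → PS → PS
dil k f n = if (n % k) ≡ᵇ 0 then f (n / k) else + 0

-- multiplicative inverse of a power series with constant term 1:
-- b 0 = 1, b (n+1) = - Σ_{i=1}^{n+1} f i * b (n+1-i).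
-- invRev f n = [b n, b (n-1), ..., b 0].
private
  conv : PS → ℕ → List ℤ → ℤ
  conv f k []       = + 0
  conv f k (b ∷ bs) = f (suc k) * b + conv f (suc k) bs

invRev : PS → ℕ → List ℤ
invRev f zero    = + 1 ∷ []
invRev f (suc n) = (- conv f 0 (invRev f n)) ∷ invRev f n

headℤ : List ℤ → ℤ
headℤ []      = + 0
headℤ (x ∷ _) = x

inv : PS → PS
inv f n = headℤ (invRev f n)

X : PS
X = ((dil 2 E) ^ˢ 4 *ˢ (dil 3 E) ^ˢ 8) *ˢ inv (E ^ˢ 8 *ˢ (dil 6 E) ^ˢ 4)

-- U (Σ a_n q^n) = Σ a_{3n} q^n   (on power series, n₀ = 0)
U : PS → PS
U f n = f (3 ℕ.* n)

_≈ˢ_ : PS → PS → Set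
f ≈ˢ g = ∀ n → f n ≡ g n
  where open import Relation.Binary.PropositionalEquality using (_≡_)
infix 4 _≈ˢ_

{-# OPTIONS --safe #-}
-- Put φ(-q) = E(q)²/E(q²), so that X = h⁴ with h = φ(-q³)/φ(-q).
--
-- Gauss's identity φ(-q) = Σ (-1)ⁿ q^(n²), obtained as the limit of
--   Σ_{i+j=m+n} (-1)^(i-m) q^((i-m)²) [i+j choose i]_{q²} = ∏_{l<m} (1-q^(2l+1)) ∏_{l<n} (1-q^(2l+1)),
-- gives the trisection φ(-q) = φ(-q⁹) + q c(q³).
--
-- The cubic norm f ↦ f(q) f(ωq) f(ω²q), written through the trisection of f so
-- that ω is not needed, is multiplicative.  It sends E(q) to E(q³)⁴/E(q⁹), hence
-- φ(-q) to φ(-q³)⁴/φ(-q⁹), while the trisection evaluates it as φ(-q⁹)³ + q³c(q³)³.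
-- Comparing the two values gives, with H = h(q³),
--   h³ = 3H³h² - 3H²h + H.
-- Since U(f(q³) g) = f U(g), the series U(hⁿ) satisfy the linear recurrence
--   U(hⁿ⁺³) = 3h³U(hⁿ⁺²) - 3h²U(hⁿ⁺¹) + hU(hⁿ),
-- with U(h⁻²) = h², U(h⁻¹) = h, U(1) = 1 read off the trisection; the theorem is
-- what it gives for U(h⁴), U(h⁸) and U(h¹²).
module Submission where

open import Defs
open import Algebra.Bundles using (CommutativeRing)
open import Algebra.Structures using (IsCommutativeRing)
open import Algebra.Solver.Ring.AlmostCommutativeRing using (fromCommutativeRing; _-Raw-AlmostCommutative⟶_)
import Algebra.Solver.Ring
open import Data.Bool using (true; false; if_then_else_)
open import Data.Integer using (+_; -_)
open import Data.Integer as ℤ using (ℤ)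
import Data.Integer.Properties as ℤₚ
open import Data.Integer.Tactic.RingSolver using (solve-∀)
open import Data.List using (List; []; _∷_)
open import Data.Maybe using (Maybe; just; nothing)
open import Data.Nat as ℕ using (ℕ; zero; suc; _∸_; _≡ᵇ_; _≤_; _<_; z≤n; s≤s; NonZero; _≤′_; ≤′-refl; ≤′-step; ∣_-_∣)
import Data.Nat.Properties as ℕₚ
open import Data.Nat.DivMod using (_/_; _%_; m<n⇒m%n≡m; [m+n]%n≡m%n; m/n≡1+[m∸n]/n; m/n≤m; m<n⇒m/n≡0)
import Data.Nat.Tactic.RingSolver as ℕ-Solver
open import Data.Product using (_×_; _,_; ∃-syntax; proj₁; proj₂)
open import Level using (0ℓ)
open import Relation.Binary.PropositionalEquality as ≡ using (_≡_; cong; cong₂; module ≡-Reasoning)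
open import Relation.Nullary using (yes; no)

-- Why `h` and not `X`: 1/h is φ(-q) divided by a series in q³, and squares are 0 or 1 modulo 3, so
-- only two of its three components are nonzero. The norm of a two-term series is a sum of two
-- cubes, which keeps the cubic relation short. The powers h⁻² and h⁻¹ can be trisected by
-- inspection, the positive powers cannot; hence the recurrence starts at -2. The return to `X` is
-- automatic. The coefficients h³, h², h of the recurrence and its three starting values keep the
-- exponents of h in U(hⁿ) in the class of -n modulo 4, so U(h⁴ʲ) is a polynomial in h⁴ = X. The
-- obstacle is that infinite products are given only coefficient by coefficient. Identities between
-- them are proved for finite products and then transferred by congruences modulo q^N for every N,
-- each step keeping account of the precision that survives.

-- Wrapping _≈ˢ_ in a record keeps both series inferable from the type of an equation.
record _≋_ (f g : PS) : Set where
  constructor mk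
  field at : f ≈ˢ g
open _≋_
infix 4 _≋_

-- The commutative ring of power series

tail : PS → PS
tail f n = f (suc n)

q : PS
q zero          = + 0
q (suc zero)    = + 1
q (suc (suc _)) = + 0

const : ℤ → PS
const c zero    = c
const c (suc _) = + 0

sumTo-cong : ∀ n {f g : ℕ → ℤ} → (∀ i → i ≤ n → f i ≡ g i) → sumTo n f ≡ sumTo n g
sumTo-cong zero    h = h zero z≤n
sumTo-cong (suc n) h =
  cong₂ ℤ._+_ (sumTo-cong n (λ i i≤n → h i (ℕₚ.m≤n⇒m≤1+n i≤n))) (h (suc n) ℕₚ.≤-refl)

sumTo-suc : ∀ n (f : ℕ → ℤ) → sumTo (suc n) f ≡ f 0 ℤ.+ sumTo n (λ i → f (suc i))
sumTo-suc zero    f = ≡.refl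
sumTo-suc (suc n) f =
  ≡.trans (cong (ℤ._+ f (suc (suc n))) (sumTo-suc n f)) (ℤₚ.+-assoc (f 0) _ _)

*ˢ-head : ∀ f g n → (f *ˢ g) (suc n) ≡ f 0 ℤ.* g (suc n) ℤ.+ (tail f *ˢ g) n
*ˢ-head f g n = sumTo-suc n _

*ˢ-last : ∀ f g n → (f *ˢ g) (suc n) ≡ (f *ˢ tail g) n ℤ.+ f (suc n) ℤ.* g 0
*ˢ-last f g n = cong₂ ℤ._+_
  (sumTo-cong n (λ i i≤n → cong (λ j → f i ℤ.* g j) (ℕₚ.+-∸-assoc 1 i≤n)))
  (cong (λ j → f (suc n) ℤ.* g j) (ℕₚ.n∸n≡0 n))

-- Coefficient n of a product sees only coefficients up to n of the factors. This bounded form is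
-- what later makes multiplication respect congruence modulo q^N.
*ˢ-cong-≤ : ∀ n {f f′ g g′ : PS} → (∀ i → i ≤ n → f i ≡ f′ i) → (∀ i → i ≤ n → g i ≡ g′ i) →
            (f *ˢ g) n ≡ (f′ *ˢ g′) n
*ˢ-cong-≤ n hf hg = sumTo-cong n (λ i i≤n → cong₂ ℤ._*_ (hf i i≤n) (hg (n ∸ i) (ℕₚ.m∸n≤m n i)))

*ˢ-cong : ∀ {f f′ g g′} → f ≋ f′ → g ≋ g′ → f *ˢ g ≋ f′ *ˢ g′
*ˢ-cong hf hg = mk λ n → *ˢ-cong-≤ n (λ i _ → at hf i) (λ i _ → at hg i)

-- Induction on the index with the series left general: peeling the first term of one product and
-- the last term of the other leaves the same claim for `tail f` at a smaller index.
*ˢ-comm-at : ∀ n f g → (f *ˢ g) n ≡ (g *ˢ f) n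
*ˢ-comm-at zero    f g = ℤₚ.*-comm (f 0) (g 0)
*ˢ-comm-at (suc n) f g = begin
  (f *ˢ g) (suc n)                            ≡⟨ *ˢ-head f g n ⟩
  f 0 ℤ.* g (suc n) ℤ.+ (tail f *ˢ g) n       ≡⟨ cong₂ ℤ._+_ (ℤₚ.*-comm (f 0) _) (*ˢ-comm-at n (tail f) g) ⟩
  g (suc n) ℤ.* f 0 ℤ.+ (g *ˢ tail f) n       ≡⟨ ℤₚ.+-comm (g (suc n) ℤ.* f 0) _ ⟩
  (g *ˢ tail f) n ℤ.+ g (suc n) ℤ.* f 0       ≡⟨ *ˢ-last g f n ⟨
  (g *ˢ f) (suc n)                            ∎
  where open ≡-Reasoning

*ˢ-distribʳ-at : ∀ n f g h → ((g +ˢ h) *ˢ f) n ≡ (g *ˢ f) n ℤ.+ (h *ˢ f) n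
*ˢ-distribʳ-at zero    f g h = ℤₚ.*-distribʳ-+ (f 0) (g 0) (h 0)
*ˢ-distribʳ-at (suc n) f g h
  rewrite *ˢ-head (g +ˢ h) f n | *ˢ-head g f n | *ˢ-head h f n | *ˢ-distribʳ-at n f (tail g) (tail h)
  = lemma (g 0) (h 0) (f (suc n)) ((tail g *ˢ f) n) ((tail h *ˢ f) n)
  where
  lemma : ∀ a b c x y → (a ℤ.+ b) ℤ.* c ℤ.+ (x ℤ.+ y) ≡ a ℤ.* c ℤ.+ x ℤ.+ (b ℤ.* c ℤ.+ y)
  lemma = solve-∀

·ˢ-*ˢ-at : ∀ n c f g → ((c ·ˢ f) *ˢ g) n ≡ c ℤ.* (f *ˢ g) n
·ˢ-*ˢ-at zero    c f g = ℤₚ.*-assoc c (f 0) (g 0)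
·ˢ-*ˢ-at (suc n) c f g
  rewrite *ˢ-head (c ·ˢ f) g n | *ˢ-head f g n | ·ˢ-*ˢ-at n c (tail f) g
  = lemma c (f 0) (g (suc n)) ((tail f *ˢ g) n)
  where
  lemma : ∀ c a b x → c ℤ.* a ℤ.* b ℤ.+ c ℤ.* x ≡ c ℤ.* (a ℤ.* b ℤ.+ x)
  lemma = solve-∀

*ˢ-assoc-at : ∀ n f g h → ((f *ˢ g) *ˢ h) n ≡ (f *ˢ (g *ˢ h)) n
*ˢ-assoc-at zero    f g h = ℤₚ.*-assoc (f 0) (g 0) (h 0)
*ˢ-assoc-at (suc n) f g h = begin
  ((f *ˢ g) *ˢ h) (suc n)
    ≡⟨ *ˢ-head (f *ˢ g) h n ⟩
  f 0 ℤ.* g 0 ℤ.* h (suc n) ℤ.+ (tail (f *ˢ g) *ˢ h) n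
    ≡⟨ cong (ℤ._+_ (f 0 ℤ.* g 0 ℤ.* h (suc n)))
         (*ˢ-cong-≤ n {g = h} (λ i _ → *ˢ-head f g i) (λ _ _ → ≡.refl)) ⟩
  f 0 ℤ.* g 0 ℤ.* h (suc n) ℤ.+ (((f 0 ·ˢ tail g) +ˢ (tail f *ˢ g)) *ˢ h) n
    ≡⟨ cong (ℤ._+_ (f 0 ℤ.* g 0 ℤ.* h (suc n))) (*ˢ-distribʳ-at n h (f 0 ·ˢ tail g) (tail f *ˢ g)) ⟩
  f 0 ℤ.* g 0 ℤ.* h (suc n) ℤ.+ (((f 0 ·ˢ tail g) *ˢ h) n ℤ.+ ((tail f *ˢ g) *ˢ h) n)
    ≡⟨ cong (ℤ._+_ (f 0 ℤ.* g 0 ℤ.* h (suc n)))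
         (cong₂ ℤ._+_ (·ˢ-*ˢ-at n (f 0) (tail g) h) (*ˢ-assoc-at n (tail f) g h)) ⟩
  f 0 ℤ.* g 0 ℤ.* h (suc n) ℤ.+ (f 0 ℤ.* (tail g *ˢ h) n ℤ.+ (tail f *ˢ (g *ˢ h)) n)
    ≡⟨ lemma (f 0) (g 0) (h (suc n)) ((tail g *ˢ h) n) ((tail f *ˢ (g *ˢ h)) n) ⟩
  f 0 ℤ.* (g 0 ℤ.* h (suc n) ℤ.+ (tail g *ˢ h) n) ℤ.+ (tail f *ˢ (g *ˢ h)) n
    ≡⟨ cong (λ z → f 0 ℤ.* z ℤ.+ (tail f *ˢ (g *ˢ h)) n) (*ˢ-head g h n) ⟨
  f 0 ℤ.* (g *ˢ h) (suc n) ℤ.+ (tail f *ˢ (g *ˢ h)) n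
    ≡⟨ *ˢ-head f (g *ˢ h) n ⟨
  (f *ˢ (g *ˢ h)) (suc n) ∎
  where
  open ≡-Reasoning
  lemma : ∀ a b c x y → a ℤ.* b ℤ.* c ℤ.+ (a ℤ.* x ℤ.+ y) ≡ a ℤ.* (b ℤ.* c ℤ.+ x) ℤ.+ y
  lemma = solve-∀

const-*ˢ-at : ∀ n c f → (const c *ˢ f) n ≡ c ℤ.* f n
const-*ˢ-at zero    c f = ≡.refl
const-*ˢ-at (suc n) c f = begin
  (const c *ˢ f) (suc n)                    ≡⟨ *ˢ-head (const c) f n ⟩
  c ℤ.* f (suc n) ℤ.+ ((λ _ → + 0) *ˢ f) n  ≡⟨ cong (ℤ._+_ (c ℤ.* f (suc n))) (zero-at n) ⟩
  c ℤ.* f (suc n) ℤ.+ + 0                   ≡⟨ ℤₚ.+-identityʳ _ ⟩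
  c ℤ.* f (suc n)                           ∎
  where
  open ≡-Reasoning
  zero-at : ∀ n → ((λ _ → + 0) *ˢ f) n ≡ + 0
  zero-at zero    = ≡.refl
  zero-at (suc n) = cong₂ ℤ._+_ (≡.trans (sumTo-cong n (λ _ _ → ≡.refl)) (zero-at n)) ≡.refl

oneˢ-const : ∀ n → oneˢ n ≡ const (+ 1) n
oneˢ-const zero    = ≡.refl
oneˢ-const (suc _) = ≡.refl

*ˢ-identityˡ-at : ∀ n f → (oneˢ *ˢ f) n ≡ f n
*ˢ-identityˡ-at n f = begin
  (oneˢ *ˢ f) n         ≡⟨ *ˢ-cong-≤ n {g = f} (λ i _ → oneˢ-const i) (λ _ _ → ≡.refl) ⟩
  (const (+ 1) *ˢ f) n  ≡⟨ const-*ˢ-at n (+ 1) f ⟩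
  + 1 ℤ.* f n           ≡⟨ ℤₚ.*-identityˡ (f n) ⟩
  f n                   ∎
  where open ≡-Reasoning

zeroˢ : PS
zeroˢ = const (+ 0)

zeroˢ-at : ∀ n → zeroˢ n ≡ + 0
zeroˢ-at zero    = ≡.refl
zeroˢ-at (suc _) = ≡.refl

*ˢ-isCommutativeRing : IsCommutativeRing _≋_ _+ˢ_ _*ˢ_ (λ f n → - f n) zeroˢ oneˢ
*ˢ-isCommutativeRing = record
  { isRing = record
    { +-isAbelianGroup = record
      { isGroup = record
        { isMonoid = record
          { isSemigroup = record
            { isMagma = record
              { isEquivalence = record
                { refl  = mk λ _ → ≡.refl
                ; sym   = λ p → mk λ n → ≡.sym (at p n)
                ; trans = λ p r → mk λ n → ≡.trans (at p n) (at r n) }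
              ; ∙-cong = λ p r → mk λ n → cong₂ ℤ._+_ (at p n) (at r n) }
            ; assoc = λ f g h → mk λ n → ℤₚ.+-assoc (f n) (g n) (h n) }
          ; identity = (λ f → mk λ n → ≡.trans (cong (ℤ._+ f n) (zeroˢ-at n)) (ℤₚ.+-identityˡ (f n)))
                     , (λ f → mk λ n → ≡.trans (cong (ℤ._+_ (f n)) (zeroˢ-at n)) (ℤₚ.+-identityʳ (f n))) }
        ; inverse = (λ f → mk λ n → ≡.trans (ℤₚ.+-inverseˡ (f n)) (≡.sym (zeroˢ-at n)))
                  , (λ f → mk λ n → ≡.trans (ℤₚ.+-inverseʳ (f n)) (≡.sym (zeroˢ-at n)))
        ; ⁻¹-cong = λ p → mk λ n → cong -_ (at p n) }
      ; comm = λ f g → mk λ n → ℤₚ.+-comm (f n) (g n) }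
    ; *-cong = *ˢ-cong
    ; *-assoc = λ f g h → mk λ n → *ˢ-assoc-at n f g h
    ; *-identity = (λ f → mk λ n → *ˢ-identityˡ-at n f)
                 , (λ f → mk λ n → ≡.trans (*ˢ-comm-at n f oneˢ) (*ˢ-identityˡ-at n f))
    ; distrib = (λ f g h → mk λ n → ≡.trans (*ˢ-comm-at n f (g +ˢ h)) (≡.trans (*ˢ-distribʳ-at n f g h)
                    (cong₂ ℤ._+_ (*ˢ-comm-at n g f) (*ˢ-comm-at n h f))))
              , (λ f g h → mk λ n → *ˢ-distribʳ-at n f g h)
    }
  ; *-comm = λ f g → mk λ n → *ˢ-comm-at n f g }

-- The operations are abstract so that unification compares them argumentwise
-- instead of unfolding both sides to sums of coefficients.
abstract
  infixl 6 _+_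
  infixl 7 _*_
  infix  8 -ˢ_

  _+_ _*_ : PS → PS → PS
  _+_ = _+ˢ_
  _*_ = _*ˢ_

  -ˢ_ : PS → PS
  (-ˢ f) n = - f n

  isCommutativeRing : IsCommutativeRing _≋_ _+_ _*_ -ˢ_ zeroˢ oneˢ
  isCommutativeRing = *ˢ-isCommutativeRing

  *≡*ˢ : ∀ f g → f * g ≡ f *ˢ g
  *≡*ˢ f g = ≡.refl

  +-at : ∀ f g n → (f + g) n ≡ f n ℤ.+ g n
  +-at f g n = ≡.refl

  -ˢ-at : ∀ f n → (-ˢ f) n ≡ - f n
  -ˢ-at f n = ≡.refl

  *-at-0 : ∀ f g → (f * g) 0 ≡ f 0 ℤ.* g 0
  *-at-0 f g = ≡.refl

  *-at-suc : ∀ f g n → (f * g) (suc n) ≡ f 0 ℤ.* g (suc n) ℤ.+ (tail f * g) n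
  *-at-suc = *ˢ-head

  *-cong-≤ : ∀ n {f f′ g g′ : PS} → (∀ i → i ≤ n → f i ≡ f′ i) → (∀ i → i ≤ n → g i ≡ g′ i) →
             (f * g) n ≡ (f′ * g′) n
  *-cong-≤ = *ˢ-cong-≤

  const-*-at : ∀ c f n → (const c * f) n ≡ c ℤ.* f n
  const-*-at c f n = const-*ˢ-at n c f

infixl 6 _-_
_-_ : PS → PS → PS
f - g = f + -ˢ g

infixr 8 _^_
_^_ : PS → ℕ → PS
f ^ zero  = oneˢ
f ^ suc k = f * f ^ k

^≡^ˢ : ∀ f k → f ^ k ≡ f ^ˢ k
^≡^ˢ f zero    = ≡.refl
^≡^ˢ f (suc k) = ≡.trans (*≡*ˢ f (f ^ k)) (cong (λ g → f *ˢ g) (^≡^ˢ f k))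

PS-ring : CommutativeRing 0ℓ 0ℓ
PS-ring = record { isCommutativeRing = isCommutativeRing }

open CommutativeRing PS-ring
  using (refl; sym; trans; setoid; *-comm; *-assoc; *-identityˡ; *-identityʳ;
         +-cong; +-congˡ; +-congʳ; *-cong; *-congˡ; *-congʳ; -‿cong; +-identityˡ; +-identityʳ)

-- Gives the ring solver integer coefficients, on which it can compute and decide equality.
const-homo : CommutativeRing.rawRing ℤₚ.+-*-commutativeRing -Raw-AlmostCommutative⟶ fromCommutativeRing PS-ring
const-homo = record
  { ⟦_⟧    = const
  ; +-homo = λ a b → mk λ where
      zero    → ≡.sym (+-at (const a) (const b) 0)
      (suc n) → ≡.sym (+-at (const a) (const b) (suc n))
  ; *-homo = λ a b → mk λ where
      zero    → ≡.sym (*-at-0 (const a) (const b))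
      (suc n) → ≡.sym (≡.trans (const-*-at a (const b) (suc n)) (ℤₚ.*-zeroʳ a))
  ; -‿homo = λ a → mk λ where
      zero    → ≡.sym (-ˢ-at (const a) 0)
      (suc n) → ≡.sym (-ˢ-at (const a) (suc n))
  ; 0-homo = refl
  ; 1-homo = mk λ n → ≡.sym (oneˢ-const n)
  }

const-≟ : (a b : ℤ) → Maybe (const a ≋ const b)
const-≟ a b with a ℤ.≟ b
... | yes ≡.refl = just refl
... | no _       = nothing

module PS-Solver = Algebra.Solver.Ring (CommutativeRing.rawRing ℤₚ.+-*-commutativeRing)
             (fromCommutativeRing PS-ring) const-homo const-≟
open PS-Solver using (solve; _:+_; _:*_; _:-_; :-_; _:^_; _:=_; con)

open import Relation.Binary.Reasoning.Setoid setoid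

-- The variable q

q*-zero : ∀ f → (q * f) 0 ≡ + 0
q*-zero f = ≡.trans (*-at-0 q f) (ℤₚ.*-zeroˡ (f 0))

q*-suc : ∀ f n → (q * f) (suc n) ≡ f n
q*-suc f n = ≡.trans (*-at-suc q f n) (≡.trans (cong₂ ℤ._+_ (ℤₚ.*-zeroˡ (f (suc n)))
  (≡.trans (*-cong-≤ n {g = f} (λ i _ → tail-q i) (λ _ _ → ≡.refl)) (at (*-identityˡ f) n))) (ℤₚ.+-identityˡ (f n)))
  where
  tail-q : ∀ i → q (suc i) ≡ oneˢ i
  tail-q zero    = ≡.refl
  tail-q (suc _) = ≡.refl

head-tail : ∀ f → f ≋ const (f 0) + q * tail f
head-tail f = mk λ where
  zero    → ≡.sym (≡.trans (+-at _ (q * tail f) 0)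
              (≡.trans (cong (ℤ._+_ (f 0)) (q*-zero (tail f))) (ℤₚ.+-identityʳ (f 0))))
  (suc n) → ≡.sym (≡.trans (+-at _ (q * tail f) (suc n)) (≡.trans (ℤₚ.+-identityˡ _) (q*-suc (tail f) n)))

^-+ : ∀ f m n → f ^ (m ℕ.+ n) ≋ f ^ m * f ^ n
^-+ f zero    n = sym (*-identityˡ _)
^-+ f (suc m) n = trans (*-congˡ (^-+ f m n)) (sym (*-assoc f _ _))

q^*-+ : ∀ k f n → (q ^ k * f) (k ℕ.+ n) ≡ f n
q^*-+ zero    f n = at (*-identityˡ f) n
q^*-+ (suc k) f n = ≡.trans (at (*-assoc q (q ^ k) f) (suc k ℕ.+ n))
  (≡.trans (q*-suc (q ^ k * f) (k ℕ.+ n)) (q^*-+ k f n))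

q^*-< : ∀ k f n → n < k → (q ^ k * f) n ≡ + 0
q^*-< (suc k) f zero    _         = ≡.trans (at (*-assoc q (q ^ k) f) 0) (q*-zero (q ^ k * f))
q^*-< (suc k) f (suc n) (s≤s n<k) = ≡.trans (at (*-assoc q (q ^ k) f) (suc n))
  (≡.trans (q*-suc (q ^ k * f) n) (q^*-< k f n n<k))

-- Congruence modulo q^N

record _≈[_]_ (f : PS) (N : ℕ) (g : PS) : Set where
  constructor mkₙ
  field atₙ : ∀ n → n < N → f n ≡ g n
open _≈[_]_
infix 4 _≈[_]_

module _ {N : ℕ} where
  ≋⇒≈ : ∀ {f g} → f ≋ g → f ≈[ N ] g
  ≋⇒≈ p = mkₙ λ n _ → at p n

  ≈-refl : ∀ {f} → f ≈[ N ] f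
  ≈-refl = mkₙ λ _ _ → ≡.refl

  ≈-sym : ∀ {f g} → f ≈[ N ] g → g ≈[ N ] f
  ≈-sym p = mkₙ λ n n<N → ≡.sym (atₙ p n n<N)

  ≈-trans : ∀ {f g h} → f ≈[ N ] g → g ≈[ N ] h → f ≈[ N ] h
  ≈-trans p r = mkₙ λ n n<N → ≡.trans (atₙ p n n<N) (atₙ r n n<N)

  ≈-resp : ∀ {f f′ g g′} → f′ ≋ f → g′ ≋ g → f ≈[ N ] g → f′ ≈[ N ] g′
  ≈-resp p r s = ≈-trans (≋⇒≈ p) (≈-trans s (≋⇒≈ (sym r)))

  ≈-+ : ∀ {f f′ g g′} → f ≈[ N ] f′ → g ≈[ N ] g′ → f + g ≈[ N ] f′ + g′
  ≈-+ p r = mkₙ λ n n<N → ≡.trans (+-at _ _ n) (≡.trans (cong₂ ℤ._+_ (atₙ p n n<N) (atₙ r n n<N)) (≡.sym (+-at _ _ n)))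

  ≈-* : ∀ {f f′ g g′} → f ≈[ N ] f′ → g ≈[ N ] g′ → f * g ≈[ N ] f′ * g′
  ≈-* p r = mkₙ λ n n<N → *-cong-≤ n (λ i i≤n → atₙ p i (ℕₚ.≤-<-trans i≤n n<N))
                                      (λ i i≤n → atₙ r i (ℕₚ.≤-<-trans i≤n n<N))

  ≈-^ : ∀ {f f′} k → f ≈[ N ] f′ → f ^ k ≈[ N ] f′ ^ k
  ≈-^ zero    p = ≈-refl
  ≈-^ (suc k) p = ≈-* p (≈-^ k p)

≈-weaken : ∀ {M N f g} → M ≤ N → f ≈[ N ] g → f ≈[ M ] g
≈-weaken M≤N p = mkₙ λ n n<M → atₙ p n (ℕₚ.<-≤-trans n<M M≤N)

≈⇒≋ : ∀ {f g} → (∀ N → f ≈[ N ] g) → f ≋ g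
≈⇒≋ p = mk λ n → atₙ (p (suc n)) n ℕₚ.≤-refl

-- A factor q^k buys k more exact coefficients. This gain drives the inductions on precision for
-- dilations and trisections, and it controls the outer terms of the finite Gauss sum in `wB-≈`.
≈-q^ : ∀ k {N f g} → f ≈[ N ] g → q ^ k * f ≈[ k ℕ.+ N ] q ^ k * g
≈-q^ zero    p = ≈-* ≈-refl p
≈-q^ (suc k) {N} {f} {g} p =
  ≈-resp (*-assoc q (q ^ k) f) (*-assoc q (q ^ k) g) (mkₙ λ where
    zero    _         → ≡.trans (q*-zero (q ^ k * f)) (≡.sym (q*-zero (q ^ k * g)))
    (suc n) (s≤s n<N) → ≡.trans (q*-suc (q ^ k * f) n)
      (≡.trans (atₙ (≈-q^ k p) n n<N) (≡.sym (q*-suc (q ^ k * g) n))))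

^-cong : ∀ {f g} k → f ≋ g → f ^ k ≋ g ^ k
^-cong zero    p = refl
^-cong (suc k) p = *-cong p (^-cong k p)

^-* : ∀ k f g → (f * g) ^ k ≋ f ^ k * g ^ k
^-* zero    f g = sym (*-identityˡ _)
^-* (suc k) f g = trans (*-congˡ (^-* k f g))
  (solve 4 (λ a b c d → (a :* b) :* (c :* d) := (a :* c) :* (b :* d)) refl f g (f ^ k) (g ^ k))

-- Inverses

-- The function conv of Defs is private, so the left-hand side of conv-spec is
-- left to be inferred from its use in inv-suc; abstracting the 0 there makes it
-- a function of the distinct variables f, k and n.
mutual
  inv-suc : ∀ f n → inv f (suc n) ≡ - ((λ i → f (suc (i ℕ.+ 0))) * inv f) n
  inv-suc f n with 0
  ... | k = cong -_ (conv-spec f k n)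

  conv-spec : ∀ f k n → _ ≡ ((λ i → f (suc (i ℕ.+ k))) * inv f) n
  conv-spec f k zero    = ≡.trans (ℤₚ.+-identityʳ _) (≡.sym (*-at-0 _ (inv f)))
  conv-spec f k (suc n) = ≡.sym (≡.trans (*-at-suc _ (inv f) n) (cong (ℤ._+_ (f (suc k) ℤ.* inv f (suc n)))
    (≡.trans (*-cong-≤ n {g = inv f} (λ i _ → cong (λ j → f (suc j)) (≡.sym (ℕₚ.+-suc i k))) (λ _ _ → ≡.refl))
             (≡.sym (conv-spec f (suc k) n)))))

inv-inverseʳ : ∀ f → f 0 ≡ + 1 → f * inv f ≋ oneˢ
inv-inverseʳ f f₀≡1 = mk λ where
  zero    → ≡.trans (*-at-0 f (inv f)) (≡.trans (ℤₚ.*-identityʳ (f 0)) f₀≡1)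
  (suc n) → ≡.trans (*-at-suc f (inv f) n) (≡.trans
    (cong₂ ℤ._+_ (≡.trans (cong (ℤ._* inv f (suc n)) f₀≡1) (ℤₚ.*-identityˡ (inv f (suc n))))
                 (*-cong-≤ n {g = inv f} (λ i _ → cong (λ j → f (suc j)) (≡.sym (ℕₚ.+-identityʳ i))) (λ _ _ → ≡.refl)))
    (≡.trans (cong (λ z → z ℤ.+ ((λ i → f (suc (i ℕ.+ 0))) * inv f) n) (inv-suc f n))
      (ℤₚ.+-inverseˡ (((λ i → f (suc (i ℕ.+ 0))) * inv f) n))))

*-cancelˡ : ∀ u {f g} → u 0 ≡ + 1 → u * f ≋ u * g → f ≋ g
*-cancelˡ u {f} {g} u₀≡1 p = begin
  f                ≈⟨ expand f ⟩
  inv u * (u * f)  ≈⟨ *-congˡ p ⟩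
  inv u * (u * g)  ≈⟨ expand g ⟨
  g                ∎
  where
  expand : ∀ h → h ≋ inv u * (u * h)
  expand h = begin
    h                ≈⟨ *-identityˡ h ⟨
    oneˢ * h         ≈⟨ *-congʳ (inv-inverseʳ u u₀≡1) ⟨
    u * inv u * h    ≈⟨ solve 3 (λ u v h → u :* v :* h := v :* (u :* h)) refl u (inv u) h ⟩
    inv u * (u * h)  ∎

-- Dilations

module _ (k : ℕ) .{{_ : NonZero k}} where

  dil-cong : ∀ {f g} → f ≋ g → dil k f ≋ dil k g
  dil-cong p = mk λ n → cong (λ z → if (n % k) ≡ᵇ 0 then z else + 0) (at p (n / k))

  dil-≈ : ∀ {N f g} → f ≈[ N ] g → dil k f ≈[ N ] dil k g
  dil-≈ p = mkₙ λ n n<N → cong (λ z → if (n % k) ≡ᵇ 0 then z else + 0)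
    (atₙ p (n / k) (ℕₚ.≤-<-trans (m/n≤m n k) n<N))

  dil-+ : ∀ f g → dil k (f + g) ≋ dil k f + dil k g
  dil-+ f g = mk λ n → ≡.trans (split n) (≡.sym (+-at (dil k f) (dil k g) n))
    where
    split : ∀ n → dil k (f + g) n ≡ dil k f n ℤ.+ dil k g n
    split n with (n % k) ≡ᵇ 0
    ... | true  = +-at f g (n / k)
    ... | false = ≡.refl

  dil-const* : ∀ c f → dil k (const c * f) ≋ const c * dil k f
  dil-const* c f = mk λ n → ≡.trans (split n) (≡.sym (const-*-at c (dil k f) n))
    where
    split : ∀ n → dil k (const c * f) n ≡ c ℤ.* dil k f n
    split n with (n % k) ≡ᵇ 0
    ... | true  = const-*-at c f (n / k)
    ... | false = ≡.sym (ℤₚ.*-zeroʳ c)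

  -- The recursive description of dilation. Apart from the linearity lemmas, this is where the
  -- arithmetic of `/` and `%` is dealt with; products, powers and iterated dilations then follow
  -- from this equation.
  dil-head-tail : ∀ f → dil k f ≋ const (f 0) + q ^ k * dil k (tail f)
  dil-head-tail f = mk λ n → ≡.trans (split n) (≡.sym (+-at (const (f 0)) (q ^ k * dil k (tail f)) n))
    where
    low : ∀ n → n < k → dil k f n ≡ const (f 0) n
    low zero    0<k rewrite m<n⇒m%n≡m 0<k = cong f (m<n⇒m/n≡0 0<k)
    low (suc n) n<k rewrite m<n⇒m%n≡m n<k = ≡.refl

    high : ∀ n → dil k f (k ℕ.+ n) ≡ dil k (tail f) n
    high n = cong₂ (λ r d → if r ≡ᵇ 0 then f d else + 0)
      (≡.trans (cong (_% k) (ℕₚ.+-comm k n)) ([m+n]%n≡m%n n k))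
      (≡.trans (m/n≡1+[m∸n]/n (ℕₚ.m≤m+n k n)) (cong (λ m → suc (m / k)) (ℕₚ.m+n∸m≡n k n)))

    const-high : ∀ n → k ≤ n → const (f 0) n ≡ + 0
    const-high zero    k≤0 with () ← ℕ.≢-nonZero⁻¹ k (ℕₚ.n≤0⇒n≡0 k≤0)
    const-high (suc n) _   = ≡.refl

    split : ∀ n → dil k f n ≡ const (f 0) n ℤ.+ (q ^ k * dil k (tail f)) n
    split n with n ℕₚ.<? k
    ... | yes n<k = ≡.trans (low n n<k) (≡.sym (≡.trans (cong (ℤ._+_ (const (f 0) n)) (q^*-< k _ n n<k)) (ℤₚ.+-identityʳ _)))
    ... | no  n≮k = ≡.trans (cong (dil k f) (≡.sym k+m≡n)) (≡.trans (high m) (≡.sym (≡.trans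
          (cong₂ ℤ._+_ (const-high n (ℕₚ.≮⇒≥ n≮k)) (≡.trans (cong (q ^ k * dil k (tail f)) (≡.sym k+m≡n)) (q^*-+ k _ m)))
          (ℤₚ.+-identityˡ _))))
      where
      m = n ∸ k
      k+m≡n = ℕₚ.m+[n∸m]≡n (ℕₚ.≮⇒≥ n≮k)

-- con c ^ 0 denotes oneˢ itself, whereas con (+ 1) denotes const (+ 1).
:1 : ∀ {n} → PS-Solver.Polynomial n
:1 = con (+ 1) :^ 0

tail-* : ∀ f g → tail (f * g) ≋ const (f 0) * tail g + tail f * g
tail-* f g = mk λ n → ≡.trans (*-at-suc f g n)
  (≡.sym (≡.trans (+-at (const (f 0) * tail g) (tail f * g) n)
    (cong (λ z → z ℤ.+ (tail f * g) n) (const-*-at (f 0) (tail g) n))))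

head-* : ∀ f g → const ((f * g) 0) ≋ const (f 0) * const (g 0)
head-* f g = mk λ n → ≡.trans (cong (λ c → const c n) (*-at-0 f g))
  (≡.sym (at (solve 0 (con (f 0) :* con (g 0) := con (f 0 ℤ.* g 0)) refl) n))

^-^ : ∀ f m n → (f ^ m) ^ n ≋ f ^ (m ℕ.* n)
^-^ f m zero    rewrite ℕₚ.*-zeroʳ m = refl
^-^ f m (suc n) rewrite ℕₚ.*-suc m n = trans (*-congˡ (^-^ f m n)) (sym (^-+ f m (m ℕ.* n)))

module _ (k : ℕ) .{{nz : NonZero k}} where

  private
    1+N≤k+N : ∀ N → suc N ≤ k ℕ.+ N
    1+N≤k+N N = ℕₚ.+-monoˡ-≤ N (ℕ.>-nonZero⁻¹ k)

  -- The induction step for series defined by recursion behind a factor q^k: agreement of the tails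
  -- modulo q^N gives agreement modulo q^(N+1). Two expressions obeying the same recursion are
  -- therefore equal.
  dil-step-≈ : ∀ {N f g} c → f ≈[ N ] g → c + q ^ k * f ≈[ suc N ] c + q ^ k * g
  dil-step-≈ c p = ≈-+ ≈-refl (≈-weaken (1+N≤k+N _) (≈-q^ k p))

  dil-* : ∀ f g → dil k (f * g) ≋ dil k f * dil k g
  dil-* f g = ≈⇒≋ λ N → go N f g
    where
    go : ∀ N f g → dil k (f * g) ≈[ N ] dil k f * dil k g
    go zero    f g = mkₙ λ _ ()
    go (suc N) f g = ≈-resp lhs rhs
      (dil-step-≈ (const (f 0) * const (g 0)) (≈-+ (≈-refl {f = const (f 0) * dil k (tail g)}) (go N (tail f) g)))
      where
      lhs : dil k (f * g) ≋ const (f 0) * const (g 0) + q ^ k * (const (f 0) * dil k (tail g) + dil k (tail f * g))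
      lhs = begin
        dil k (f * g)
          ≈⟨ dil-head-tail k (f * g) ⟩
        const ((f * g) 0) + q ^ k * dil k (tail (f * g))
          ≈⟨ +-cong (head-* f g) (*-congˡ (dil-cong k (tail-* f g))) ⟩
        const (f 0) * const (g 0) + q ^ k * dil k (const (f 0) * tail g + tail f * g)
          ≈⟨ +-congˡ (*-congˡ (trans (dil-+ k _ _) (+-congʳ (dil-const* k (f 0) (tail g))))) ⟩
        const (f 0) * const (g 0) + q ^ k * (const (f 0) * dil k (tail g) + dil k (tail f * g)) ∎
      rhs : dil k f * dil k g ≋ const (f 0) * const (g 0) + q ^ k * (const (f 0) * dil k (tail g) + dil k (tail f) * dil k g)
      rhs = begin
        dil k f * dil k g
          ≈⟨ *-congʳ (dil-head-tail k f) ⟩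
        (const (f 0) + q ^ k * dil k (tail f)) * dil k g
          ≈⟨ solve 4 (λ a p b c → (a :+ p :* b) :* c := a :* c :+ p :* (b :* c)) refl
               (const (f 0)) (q ^ k) (dil k (tail f)) (dil k g) ⟩
        const (f 0) * dil k g + q ^ k * (dil k (tail f) * dil k g)
          ≈⟨ +-congʳ (*-congˡ (dil-head-tail k g)) ⟩
        const (f 0) * (const (g 0) + q ^ k * dil k (tail g)) + q ^ k * (dil k (tail f) * dil k g)
          ≈⟨ solve 5 (λ a b p c d → a :* (b :+ p :* c) :+ p :* d := a :* b :+ p :* (a :* c :+ d)) refl
               (const (f 0)) (const (g 0)) (q ^ k) (dil k (tail g)) (dil k (tail f) * dil k g) ⟩
        const (f 0) * const (g 0) + q ^ k * (const (f 0) * dil k (tail g) + dil k (tail f) * dil k g) ∎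

  dil-one : dil k oneˢ ≋ oneˢ
  dil-one = begin
    dil k oneˢ                                       ≈⟨ dil-head-tail k oneˢ ⟩
    const (+ 1) + q ^ k * dil k (tail oneˢ)          ≈⟨ +-congˡ (*-congˡ (dil-cong k tail-one)) ⟩
    const (+ 1) + q ^ k * dil k (const (+ 0) * oneˢ) ≈⟨ +-congˡ (*-congˡ (dil-const* k (+ 0) oneˢ)) ⟩
    const (+ 1) + q ^ k * (const (+ 0) * dil k oneˢ)
      ≈⟨ solve 2 (λ p d → con (+ 1) :+ p :* (con (+ 0) :* d) := :1) refl (q ^ k) (dil k oneˢ) ⟩
    oneˢ                                             ∎
    where
    tail-one : tail oneˢ ≋ const (+ 0) * oneˢ
    tail-one = mk λ n → ≡.sym (const-*-at (+ 0) oneˢ n)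

  dil-const : ∀ c → dil k (const c) ≋ const c
  dil-const c = begin
    dil k (const c)          ≈⟨ dil-cong k (*-identityʳ (const c)) ⟨
    dil k (const c * oneˢ)   ≈⟨ dil-const* k c oneˢ ⟩
    const c * dil k oneˢ     ≈⟨ *-congˡ dil-one ⟩
    const c * oneˢ           ≈⟨ *-identityʳ (const c) ⟩
    const c                  ∎

  dil-neg : ∀ f → dil k (-ˢ f) ≋ -ˢ dil k f
  dil-neg f = begin
    dil k (-ˢ f)                ≈⟨ dil-cong k (solve 1 (λ f → :- f := con (- + 1) :* f) refl f) ⟩
    dil k (const (- + 1) * f)   ≈⟨ dil-const* k (- + 1) f ⟩
    const (- + 1) * dil k f     ≈⟨ solve 1 (λ f → con (- + 1) :* f := :- f) refl (dil k f) ⟩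
    -ˢ dil k f                  ∎

  dil-^ : ∀ f m → dil k (f ^ m) ≋ dil k f ^ m
  dil-^ f zero    = dil-one
  dil-^ f (suc m) = trans (dil-* f (f ^ m)) (*-congˡ (dil-^ f m))

  dil-q : dil k q ≋ q ^ k
  dil-q = begin
    dil k q                            ≈⟨ dil-head-tail k q ⟩
    const (+ 0) + q ^ k * dil k (tail q)  ≈⟨ +-congˡ (*-congˡ (trans (dil-cong k tail-q) dil-one)) ⟩
    const (+ 0) + q ^ k * oneˢ         ≈⟨ solve 1 (λ p → con (+ 0) :+ p :* :1 := p) refl (q ^ k) ⟩
    q ^ k                              ∎
    where
    tail-q : tail q ≋ oneˢ
    tail-q = mk λ { zero → ≡.refl ; (suc _) → ≡.refl }

  dil-q^ : ∀ m → dil k (q ^ m) ≋ q ^ (k ℕ.* m)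
  dil-q^ m = trans (dil-^ q m) (trans (^-cong m dil-q) (^-^ q k m))

  dil-q^* : ∀ m f → dil k (q ^ m * f) ≋ q ^ (k ℕ.* m) * dil k f
  dil-q^* m f = trans (dil-* (q ^ m) f) (*-congʳ (dil-q^ m))

  dil-head : ∀ f → dil k f 0 ≡ f 0
  dil-head f = ≡.trans (at (dil-head-tail k f) 0) (≡.trans (+-at _ _ 0)
    (≡.trans (cong (ℤ._+_ (f 0)) (q^*-< k _ 0 (ℕ.>-nonZero⁻¹ k))) (ℤₚ.+-identityʳ (f 0))))

dil-dil : ∀ j k .{{_ : NonZero j}} .{{_ : NonZero k}} f →
          dil j (dil k f) ≋ dil (j ℕ.* k) {{ℕₚ.m*n≢0 j k}} f
dil-dil j k f = ≈⇒≋ λ N → go N f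
  where
  instance _ = ℕₚ.m*n≢0 j k
  go : ∀ N f → dil j (dil k f) ≈[ N ] dil (j ℕ.* k) f
  go zero    f = mkₙ λ _ ()
  go (suc N) f = ≈-resp lhs (dil-head-tail (j ℕ.* k) f) (dil-step-≈ (j ℕ.* k) (const (f 0)) (go N (tail f)))
    where
    lhs : dil j (dil k f) ≋ const (f 0) + q ^ (j ℕ.* k) * dil j (dil k (tail f))
    lhs = begin
      dil j (dil k f)                                          ≈⟨ dil-cong j (dil-head-tail k f) ⟩
      dil j (const (f 0) + q ^ k * dil k (tail f))             ≈⟨ dil-+ j _ _ ⟩
      dil j (const (f 0)) + dil j (q ^ k * dil k (tail f))     ≈⟨ +-cong (dil-const j (f 0)) (dil-q^* j k (dil k (tail f))) ⟩
      const (f 0) + q ^ (j ℕ.* k) * dil j (dil k (tail f))     ∎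

-- Trisection

C : ℕ → PS → PS
C i f n = f (i ℕ.+ 3 ℕ.* n)

C-cong : ∀ i {f g} → f ≋ g → C i f ≋ C i g
C-cong i p = mk λ n → at p (i ℕ.+ 3 ℕ.* n)

C-+ : ∀ i f g → C i (f + g) ≋ C i f + C i g
C-+ i f g = mk λ n → ≡.trans (+-at f g (i ℕ.+ 3 ℕ.* n)) (≡.sym (+-at (C i f) (C i g) n))

C-const* : ∀ i c f → C i (const c * f) ≋ const c * C i f
C-const* i c f = mk λ n → ≡.trans (const-*-at c f (i ℕ.+ 3 ℕ.* n)) (≡.sym (const-*-at c (C i f) n))

private
  C-index : ∀ i n → i ℕ.+ 3 ℕ.* suc n ≡ 3 ℕ.+ (i ℕ.+ 3 ℕ.* n)
  C-index i n = ≡.trans (cong (i ℕ.+_) (ℕₚ.*-suc 3 n)) (≡.trans (≡.sym (ℕₚ.+-assoc i 3 (3 ℕ.* n)))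
    (cong (ℕ._+ (3 ℕ.* n)) (ℕₚ.+-comm i 3)))

C₀-q* : ∀ f → C 0 (q * f) ≋ q * C 2 f
C₀-q* f = mk λ where
  zero    → ≡.trans (q*-zero f) (≡.sym (q*-zero (C 2 f)))
  (suc n) → ≡.trans (cong (q * f) (C-index 0 n)) (≡.trans (q*-suc f (2 ℕ.+ 3 ℕ.* n)) (≡.sym (q*-suc (C 2 f) n)))

C₁-q* : ∀ f → C 1 (q * f) ≋ C 0 f
C₁-q* f = mk λ n → q*-suc f (3 ℕ.* n)

C₂-q* : ∀ f → C 2 (q * f) ≋ C 1 f
C₂-q* f = mk λ n → q*-suc f (1 ℕ.+ 3 ℕ.* n)

-- Raising n by one moves the index by 3, exactly what the factor q³ in `dil-head-tail` absorbs. At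
-- n = 0 the bound `i < 3` makes the q³ part invisible.
C-dil* : ∀ {i} → i < 3 → ∀ f g → C i (dil 3 f * g) ≋ f * C i g
C-dil* {i} i<3 f g = mk λ n → go n f
  where
  split : ∀ f n → (dil 3 f * g) n ≡ f 0 ℤ.* g n ℤ.+ (q ^ 3 * (dil 3 (tail f) * g)) n
  split f n = ≡.trans (at expand n) (≡.trans (+-at (const (f 0) * g) _ n)
      (cong (λ z → z ℤ.+ (q ^ 3 * (dil 3 (tail f) * g)) n) (const-*-at (f 0) g n)))
    where
    expand : dil 3 f * g ≋ const (f 0) * g + q ^ 3 * (dil 3 (tail f) * g)
    expand = trans (*-congʳ (dil-head-tail 3 f))
      (solve 4 (λ a p b c → (a :+ p :* b) :* c := a :* c :+ p :* (b :* c)) refl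
        (const (f 0)) (q ^ 3) (dil 3 (tail f)) g)
  go : ∀ n f → (dil 3 f * g) (i ℕ.+ 3 ℕ.* n) ≡ (f * C i g) n
  go zero    f = ≡.trans (split f (i ℕ.+ 0)) (≡.trans
    (cong (ℤ._+_ (f 0 ℤ.* g (i ℕ.+ 0))) (q^*-< 3 _ (i ℕ.+ 0) (≡.subst (_< 3) (≡.sym (ℕₚ.+-identityʳ i)) i<3)))
    (≡.trans (ℤₚ.+-identityʳ _) (≡.sym (*-at-0 f (C i g)))))
  go (suc n) f = ≡.trans (split f (i ℕ.+ 3 ℕ.* suc n)) (≡.trans
    (cong (ℤ._+_ (f 0 ℤ.* g (i ℕ.+ 3 ℕ.* suc n)))
      (≡.trans (cong (q ^ 3 * (dil 3 (tail f) * g)) (C-index i n))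
        (≡.trans (q^*-+ 3 _ (i ℕ.+ 3 ℕ.* n)) (go n (tail f)))))
    (≡.sym (*-at-suc f (C i g) n)))

tri : PS → PS → PS → PS
tri a b c = dil 3 a + q * dil 3 b + q * (q * dil 3 c)

tri-C : ∀ f → f ≋ tri (C 0 f) (C 1 f) (C 2 f)
tri-C f = ≈⇒≋ λ N → go N f
  where
  parts : PS → PS
  parts f = tri (C 0 f) (C 1 f) (C 2 f)
  tail³ : PS → PS
  tail³ f n = f (3 ℕ.+ n)
  low : PS → PS
  low f = const (f 0) + q * const (f 1) + q * (q * const (f 2))

  f-step : ∀ f → f ≋ low f + q ^ 3 * tail³ f
  f-step f = begin
    f
      ≈⟨ head-tail f ⟩
    const (f 0) + q * tail f
      ≈⟨ +-congˡ (*-congˡ (trans (head-tail (tail f)) (+-congˡ (*-congˡ (head-tail (tail (tail f))))))) ⟩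
    const (f 0) + q * (const (f 1) + q * (const (f 2) + q * tail³ f))
      ≈⟨ solve 5 (λ a b c q t → a :+ q :* (b :+ q :* (c :+ q :* t))
           := a :+ q :* b :+ q :* (q :* c) :+ q :^ 3 :* t) refl
           (const (f 0)) (const (f 1)) (const (f 2)) q (tail³ f) ⟩
    low f + q ^ 3 * tail³ f ∎

  C-step : ∀ i f → dil 3 (C i f) ≋ const (f (i ℕ.+ 0)) + q ^ 3 * dil 3 (C i (tail³ f))
  C-step i f = trans (dil-head-tail 3 (C i f)) (+-congˡ (*-congˡ (dil-cong 3 (mk λ n → cong f (C-index i n)))))

  parts-step : ∀ f → parts f ≋ low f + q ^ 3 * parts (tail³ f)
  parts-step f = trans
    (+-cong (+-cong (C-step 0 f) (*-congˡ (C-step 1 f))) (*-congˡ (*-congˡ (C-step 2 f))))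
    (solve 7 (λ a b c q x y z →
        (a :+ q :^ 3 :* x) :+ q :* (b :+ q :^ 3 :* y) :+ q :* (q :* (c :+ q :^ 3 :* z))
        := (a :+ q :* b :+ q :* (q :* c)) :+ q :^ 3 :* (x :+ q :* y :+ q :* (q :* z))) refl
      (const (f 0)) (const (f 1)) (const (f 2)) q
      (dil 3 (C 0 (tail³ f))) (dil 3 (C 1 (tail³ f))) (dil 3 (C 2 (tail³ f))))

  go : ∀ N f → f ≈[ N ] parts f
  go zero    f = mkₙ λ _ ()
  go (suc N) f = ≈-resp (f-step f) (parts-step f) (dil-step-≈ 3 (low f) (go N (tail³ f)))

0<3 : 0 < 3
0<3 = s≤s z≤n

1<3 : 1 < 3
1<3 = s≤s (s≤s z≤n)

2<3 : 2 < 3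
2<3 = s≤s (s≤s (s≤s z≤n))

module _ (a b c g : PS) where
  private
    tri*-expand : tri a b c * g ≋ dil 3 a * g + q * (dil 3 b * g) + q * (q * (dil 3 c * g))
    tri*-expand = solve 5 (λ q a b c g → (a :+ q :* b :+ q :* (q :* c)) :* g
      := a :* g :+ q :* (b :* g) :+ q :* (q :* (c :* g))) refl q (dil 3 a) (dil 3 b) (dil 3 c) g

    C-expand : ∀ i → C i (tri a b c * g) ≋
      C i (dil 3 a * g) + C i (q * (dil 3 b * g)) + C i (q * (q * (dil 3 c * g)))
    C-expand i = trans (C-cong i tri*-expand) (trans (C-+ i _ _) (+-congʳ (C-+ i _ _)))

  -- Residues of exponents add modulo 3; a sum that reaches 3 carries a q³, which becomes a factor q
  -- after trisection.
  C₀-tri* : C 0 (tri a b c * g) ≋ a * C 0 g + q * (b * C 2 g) + q * (c * C 1 g)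
  C₀-tri* = trans (C-expand 0) (+-cong (+-cong (C-dil* 0<3 a g)
    (trans (C₀-q* _) (*-congˡ (C-dil* 2<3 b g))))
    (trans (C₀-q* _) (*-congˡ (trans (C₂-q* _) (C-dil* 1<3 c g)))))

  C₁-tri* : C 1 (tri a b c * g) ≋ a * C 1 g + b * C 0 g + q * (c * C 2 g)
  C₁-tri* = trans (C-expand 1) (+-cong (+-cong (C-dil* 1<3 a g)
    (trans (C₁-q* _) (C-dil* 0<3 b g)))
    (trans (C₁-q* _) (trans (C₀-q* _) (*-congˡ (C-dil* 2<3 c g)))))

  C₂-tri* : C 2 (tri a b c * g) ≋ a * C 2 g + b * C 1 g + c * C 0 g
  C₂-tri* = trans (C-expand 2) (+-cong (+-cong (C-dil* 2<3 a g)
    (trans (C₂-q* _) (C-dil* 1<3 b g)))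
    (trans (C₂-q* _) (trans (C₁-q* _) (C-dil* 0<3 c g))))

C₀-one : C 0 oneˢ ≋ oneˢ
C₀-one = mk λ { zero → ≡.refl ; (suc _) → ≡.refl }

C₁-one : C 1 oneˢ ≋ zeroˢ
C₁-one = mk λ n → ≡.sym (zeroˢ-at n)

C₂-one : C 2 oneˢ ≋ zeroˢ
C₂-one = mk λ n → ≡.sym (zeroˢ-at n)

C₀-tri : ∀ a b c → C 0 (tri a b c) ≋ a
C₀-tri a b c = begin
  C 0 (tri a b c)                                       ≈⟨ C-cong 0 (*-identityʳ (tri a b c)) ⟨
  C 0 (tri a b c * oneˢ)                                ≈⟨ C₀-tri* a b c oneˢ ⟩
  a * C 0 oneˢ + q * (b * C 2 oneˢ) + q * (c * C 1 oneˢ)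
    ≈⟨ +-cong (+-cong (*-congˡ C₀-one) (*-congˡ (*-congˡ C₂-one))) (*-congˡ (*-congˡ C₁-one)) ⟩
  a * oneˢ + q * (b * zeroˢ) + q * (c * zeroˢ)
    ≈⟨ solve 4 (λ q a b c → a :* :1 :+ q :* (b :* con (+ 0)) :+ q :* (c :* con (+ 0)) := a) refl q a b c ⟩
  a ∎

C₁-tri : ∀ a b c → C 1 (tri a b c) ≋ b
C₁-tri a b c = begin
  C 1 (tri a b c)                                       ≈⟨ C-cong 1 (*-identityʳ (tri a b c)) ⟨
  C 1 (tri a b c * oneˢ)                                ≈⟨ C₁-tri* a b c oneˢ ⟩
  a * C 1 oneˢ + b * C 0 oneˢ + q * (c * C 2 oneˢ)
    ≈⟨ +-cong (+-cong (*-congˡ C₁-one) (*-congˡ C₀-one)) (*-congˡ (*-congˡ C₂-one)) ⟩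
  a * zeroˢ + b * oneˢ + q * (c * zeroˢ)
    ≈⟨ solve 4 (λ q a b c → a :* con (+ 0) :+ b :* :1 :+ q :* (c :* con (+ 0)) := b) refl q a b c ⟩
  b ∎

C₂-tri : ∀ a b c → C 2 (tri a b c) ≋ c
C₂-tri a b c = begin
  C 2 (tri a b c)                                       ≈⟨ C-cong 2 (*-identityʳ (tri a b c)) ⟨
  C 2 (tri a b c * oneˢ)                                ≈⟨ C₂-tri* a b c oneˢ ⟩
  a * C 2 oneˢ + b * C 1 oneˢ + c * C 0 oneˢ
    ≈⟨ +-cong (+-cong (*-congˡ C₂-one) (*-congˡ C₁-one)) (*-congˡ C₀-one) ⟩
  a * zeroˢ + b * zeroˢ + c * oneˢ
    ≈⟨ solve 3 (λ a b c → a :* con (+ 0) :+ b :* con (+ 0) :+ c :* :1 := c) refl a b c ⟩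
  c ∎

-- The cubic norm

-- norm₃ a b c evaluated at q³ is f(q) f(ωq) f(ω²q) for f = tri a b c and ω a primitive cube root of unity.
norm₃ : PS → PS → PS → PS
norm₃ a b c = a ^ 3 + q * b ^ 3 + q * (q * c ^ 3) + const (- + 3) * (q * (a * (b * c)))

norm : PS → PS
norm f = norm₃ (C 0 f) (C 1 f) (C 2 f)

norm₃-cong : ∀ {a a′ b b′ c c′} → a ≋ a′ → b ≋ b′ → c ≋ c′ → norm₃ a b c ≋ norm₃ a′ b′ c′
norm₃-cong p r s = +-cong (+-cong (+-cong (^-cong 3 p) (*-congˡ (^-cong 3 r))) (*-congˡ (*-congˡ (^-cong 3 s))))
  (*-congˡ (*-congˡ (*-cong p (*-cong r s))))

norm-cong : ∀ {f g} → f ≋ g → norm f ≋ norm g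
norm-cong p = norm₃-cong (C-cong 0 p) (C-cong 1 p) (C-cong 2 p)

norm-tri : ∀ a b c → norm (tri a b c) ≋ norm₃ a b c
norm-tri a b c = norm₃-cong (C₀-tri a b c) (C₁-tri a b c) (C₂-tri a b c)

-- This is the norm form of the extension obtained by adjoining a cube root of q, so
-- multiplicativity is a polynomial identity in q and the six components, left to the solver.
norm-* : ∀ f g → norm (f * g) ≋ norm f * norm g
norm-* f g = begin
  norm (f * g)
    ≈⟨ norm-cong (*-congʳ (tri-C f)) ⟩
  norm (tri f₀ f₁ f₂ * g)
    ≈⟨ norm₃-cong (C₀-tri* f₀ f₁ f₂ g) (C₁-tri* f₀ f₁ f₂ g) (C₂-tri* f₀ f₁ f₂ g) ⟩
  norm₃ (f₀ * g₀ + q * (f₁ * g₂) + q * (f₂ * g₁)) (f₀ * g₁ + f₁ * g₀ + q * (f₂ * g₂)) (f₀ * g₂ + f₁ * g₁ + f₂ * g₀)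
    ≈⟨ solve 7 (λ q f₀ f₁ f₂ g₀ g₁ g₂ →
         let n = λ a b c → a :^ 3 :+ q :* b :^ 3 :+ q :* (q :* c :^ 3) :+ con (- + 3) :* (q :* (a :* (b :* c))) in
         n (f₀ :* g₀ :+ q :* (f₁ :* g₂) :+ q :* (f₂ :* g₁)) (f₀ :* g₁ :+ f₁ :* g₀ :+ q :* (f₂ :* g₂))
           (f₀ :* g₂ :+ f₁ :* g₁ :+ f₂ :* g₀)
         := n f₀ f₁ f₂ :* n g₀ g₁ g₂) refl q f₀ f₁ f₂ g₀ g₁ g₂ ⟩
  norm f * norm g ∎
  where
  f₀ = C 0 f
  f₁ = C 1 f
  f₂ = C 2 f
  g₀ = C 0 g
  g₁ = C 1 g
  g₂ = C 2 g

-- Trisection divides precision by three, since coefficient n reads coefficient i + 3n. Limits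
-- involving `norm` or `C` are therefore taken along multiples of 3.
C-≈ : ∀ {i m f g} → i < 3 → f ≈[ 3 ℕ.* m ] g → C i f ≈[ m ] C i g
C-≈ {i} {m} i<3 p = mkₙ λ n n<m → atₙ p (i ℕ.+ 3 ℕ.* n) (ℕₚ.<-≤-trans (ℕₚ.+-monoˡ-< (3 ℕ.* n) i<3)
  (ℕₚ.≤-trans (ℕₚ.≤-reflexive (≡.sym (ℕₚ.*-suc 3 n))) (ℕₚ.*-monoʳ-≤ 3 n<m)))

norm-≈ : ∀ {m f g} → f ≈[ 3 ℕ.* m ] g → norm f ≈[ m ] norm g
norm-≈ p = ≈-+ (≈-+ (≈-+ (≈-^ 3 p₀) (≈-* ≈-refl (≈-^ 3 p₁))) (≈-* ≈-refl (≈-* ≈-refl (≈-^ 3 p₂))))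
  (≈-* ≈-refl (≈-* ≈-refl (≈-* p₀ (≈-* p₁ p₂))))
  where
  p₀ = C-≈ 0<3 p
  p₁ = C-≈ 1<3 p
  p₂ = C-≈ 2<3 p

dil₂-dil₃ : ∀ f → dil 2 (dil 3 f) ≋ dil 3 (dil 2 f)
dil₂-dil₃ f = trans (dil-dil 2 3 f) (sym (dil-dil 3 2 f))

-- Doubling exponents exchanges the residues 1 and 2, with a carry because 2 · 2 = 1 + 3; hence the
-- `q * dil 2 f₂` in the middle slot. The norm does not notice, since q ↦ q² only permutes the cube
-- roots of unity.
norm-dil₂ : ∀ f → norm (dil 2 f) ≋ dil 2 (norm f)
norm-dil₂ f = begin
  norm (dil 2 f)                              ≈⟨ norm-cong dil₂-tri ⟩
  norm (tri (dil 2 f₀) (q * dil 2 f₂) (dil 2 f₁))  ≈⟨ norm-tri _ _ _ ⟩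
  norm₃ (dil 2 f₀) (q * dil 2 f₂) (dil 2 f₁)
    ≈⟨ solve 4 (λ q a b c → a :^ 3 :+ q :* (q :* c) :^ 3 :+ q :* (q :* b :^ 3) :+ con (- + 3) :* (q :* (a :* (q :* c :* b)))
         := a :^ 3 :+ q :^ 2 :* b :^ 3 :+ q :^ 2 :* (q :^ 2 :* c :^ 3) :+ con (- + 3) :* (q :^ 2 :* (a :* (b :* c))))
         refl q (dil 2 f₀) (dil 2 f₁) (dil 2 f₂) ⟩
  dil 2 f₀ ^ 3 + q ^ 2 * dil 2 f₁ ^ 3 + q ^ 2 * (q ^ 2 * dil 2 f₂ ^ 3)
    + const (- + 3) * (q ^ 2 * (dil 2 f₀ * (dil 2 f₁ * dil 2 f₂)))
    ≈⟨ dil₂-norm₃ ⟨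
  dil 2 (norm f)                              ∎
  where
  f₀ = C 0 f
  f₁ = C 1 f
  f₂ = C 2 f

  dil-q* : ∀ h → dil 2 (q * h) ≋ q ^ 2 * dil 2 h
  dil-q* h = trans (dil-* 2 q h) (*-congʳ (dil-q 2))

  dil₂-tri : dil 2 f ≋ tri (dil 2 f₀) (q * dil 2 f₂) (dil 2 f₁)
  dil₂-tri = begin
    dil 2 f
      ≈⟨ dil-cong 2 (tri-C f) ⟩
    dil 2 (tri f₀ f₁ f₂)
      ≈⟨ trans (dil-+ 2 _ _) (+-congʳ (dil-+ 2 _ _)) ⟩
    dil 2 (dil 3 f₀) + dil 2 (q * dil 3 f₁) + dil 2 (q * (q * dil 3 f₂))
      ≈⟨ +-cong (+-cong (dil₂-dil₃ f₀) (trans (dil-q* _) (*-congˡ (dil₂-dil₃ f₁))))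
           (trans (dil-q* _) (*-congˡ (trans (dil-q* _) (*-congˡ (dil₂-dil₃ f₂))))) ⟩
    dil 3 (dil 2 f₀) + q ^ 2 * dil 3 (dil 2 f₁) + q ^ 2 * (q ^ 2 * dil 3 (dil 2 f₂))
      ≈⟨ solve 4 (λ q a b c → a :+ q :^ 2 :* b :+ q :^ 2 :* (q :^ 2 :* c) := a :+ q :* (q :^ 3 :* c) :+ q :* (q :* b))
           refl q (dil 3 (dil 2 f₀)) (dil 3 (dil 2 f₁)) (dil 3 (dil 2 f₂)) ⟩
    dil 3 (dil 2 f₀) + q * (q ^ 3 * dil 3 (dil 2 f₂)) + q * (q * dil 3 (dil 2 f₁))
      ≈⟨ +-congʳ (+-congˡ (*-congˡ (sym (trans (dil-* 3 q _) (*-congʳ (dil-q 3)))))) ⟩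
    tri (dil 2 f₀) (q * dil 2 f₂) (dil 2 f₁) ∎

  dil₂-norm₃ : dil 2 (norm f) ≋ dil 2 f₀ ^ 3 + q ^ 2 * dil 2 f₁ ^ 3 + q ^ 2 * (q ^ 2 * dil 2 f₂ ^ 3)
    + const (- + 3) * (q ^ 2 * (dil 2 f₀ * (dil 2 f₁ * dil 2 f₂)))
  dil₂-norm₃ = trans (dil-+ 2 _ _) (+-cong (trans (dil-+ 2 _ _) (+-cong (trans (dil-+ 2 _ _) (+-cong
      (dil-^ 2 f₀ 3)
      (trans (dil-q* _) (*-congˡ (dil-^ 2 f₁ 3)))))
      (trans (dil-q* _) (*-congˡ (trans (dil-q* _) (*-congˡ (dil-^ 2 f₂ 3)))))))
      (trans (dil-const* 2 (- + 3) _) (*-congˡ (trans (dil-q* _) (*-congˡ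
        (trans (dil-* 2 f₀ _) (*-congˡ (dil-* 2 f₁ f₂))))))))

-- Euler's product

q^-at : ∀ k n → (q ^ k) n ≡ (if n ≡ᵇ k then + 1 else + 0)
q^-at zero    zero    = ≡.refl
q^-at zero    (suc n) = ≡.refl
q^-at (suc k) zero    = q*-zero (q ^ k)
q^-at (suc k) (suc n) = ≡.trans (q*-suc (q ^ k) n) (q^-at k n)

oneMinusQ≋ : ∀ k → oneMinusQ (suc k) ≋ oneˢ - q ^ suc k
oneMinusQ≋ k = mk λ n → ≡.sym (≡.trans (+-at oneˢ (-ˢ (q ^ suc k)) n)
  (≡.trans (cong (ℤ._+_ (oneˢ n)) (≡.trans (-ˢ-at (q ^ suc k) n) (cong -_ (q^-at (suc k) n)))) (value n)))
  where
  value : ∀ n → oneˢ n ℤ.+ - (if n ≡ᵇ suc k then + 1 else + 0) ≡ oneMinusQ (suc k) n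
  value zero = ≡.refl
  value (suc n) with n ≡ᵇ k
  ... | true  = ≡.refl
  ... | false = ≡.refl

Eprod-suc : ∀ m → Eprod (suc m) ≋ Eprod m * (oneˢ - q ^ suc m)
Eprod-suc m = trans (mk λ n → cong (λ f → f n) (≡.sym (*≡*ˢ (Eprod m) (oneMinusQ (suc m)))))
  (*-congˡ (oneMinusQ≋ m))

Eprod-stable : ∀ {n m} → n ≤′ m → Eprod m n ≡ Eprod n n
Eprod-stable ≤′-refl = ≡.refl
Eprod-stable {n} (≤′-step {m} n≤m) = ≡.trans
  (≡.trans (at (trans (Eprod-suc m) (solve 2 (λ e p → e :* (:1 :- p) := e :+ p :* (:- e)) refl (Eprod m) (q ^ suc m))) n)
    (≡.trans (+-at (Eprod m) _ n) (≡.trans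
      (cong (ℤ._+_ (Eprod m n)) (q^*-< (suc m) _ n (s≤s (ℕₚ.≤′⇒≤ n≤m)))) (ℤₚ.+-identityʳ _))))
  (Eprod-stable n≤m)

Eprod-≈ : ∀ m → Eprod m ≈[ suc m ] E
Eprod-≈ m = mkₙ λ { n (s≤s n≤m) → Eprod-stable (ℕₚ.≤⇒≤′ n≤m) }

Eprod-head : ∀ m → Eprod m 0 ≡ + 1
Eprod-head m = Eprod-stable (ℕₚ.≤⇒≤′ (z≤n {m}))

-- A series in q³ is unchanged by q ↦ ωq, so the three conjugate factors coincide.
norm-dil₃ : ∀ f → norm (dil 3 f) ≋ f ^ 3
norm-dil₃ f = begin
  norm (dil 3 f)
    ≈⟨ norm-cong (trans (solve 2 (λ q d → d := d :+ q :* con (+ 0) :+ q :* (q :* con (+ 0))) refl q (dil 3 f))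
         (+-cong (+-congˡ (*-congˡ (sym (dil-const 3 (+ 0))))) (*-congˡ (*-congˡ (sym (dil-const 3 (+ 0))))))) ⟩
  norm (tri f zeroˢ zeroˢ) ≈⟨ norm-tri f zeroˢ zeroˢ ⟩
  norm₃ f zeroˢ zeroˢ      ≈⟨ solve 2 (λ q f → f :^ 3 :+ q :* con (+ 0) :^ 3 :+ q :* (q :* con (+ 0) :^ 3)
                                :+ con (- + 3) :* (q :* (f :* (con (+ 0) :* con (+ 0)))) := f :^ 3) refl q f ⟩
  f ^ 3                    ∎

q^3 : ∀ m → (q ^ m) ^ 3 ≋ q ^ (3 ℕ.* m)
q^3 m = trans (^-^ q m 3) (mk λ n → cong (λ j → (q ^ j) n) (ℕₚ.*-comm m 3))

-- For k prime to 3 the conjugates 1 - (ωʲq)^k multiply to 1 - q^(3k), and the norm is this product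
-- read as a series in q³.
norm-1-q^3m+1 : ∀ m → norm (oneˢ - q ^ (1 ℕ.+ 3 ℕ.* m)) ≋ oneˢ - q ^ (1 ℕ.+ 3 ℕ.* m)
norm-1-q^3m+1 m = begin
  norm (oneˢ - q * q ^ (3 ℕ.* m))
    ≈⟨ norm-cong (trans (solve 2 (λ q y → :1 :- q :* y
           := :1 :+ q :* (:- y) :+ q :* (q :* con (+ 0)))
           refl q (q ^ (3 ℕ.* m)))
         (+-cong (+-cong (sym (dil-one 3)) (*-congˡ (sym (trans (dil-neg 3 _) (-‿cong (dil-q^ 3 m))))))
           (*-congˡ (*-congˡ (sym (dil-const 3 (+ 0))))))) ⟩
  norm (tri oneˢ (-ˢ (q ^ m)) zeroˢ)
    ≈⟨ norm-tri _ _ _ ⟩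
  norm₃ oneˢ (-ˢ (q ^ m)) zeroˢ
    ≈⟨ solve 2 (λ q x → :1 :^ 3 :+ q :* (:- x) :^ 3 :+ q :* (q :* con (+ 0) :^ 3)
         :+ con (- + 3) :* (q :* (:1 :* ((:- x) :* con (+ 0)))) := :1 :- q :* x :^ 3) refl q (q ^ m) ⟩
  oneˢ - q * (q ^ m) ^ 3
    ≈⟨ +-congˡ (-‿cong (*-congˡ (q^3 m))) ⟩
  oneˢ - q * q ^ (3 ℕ.* m) ∎

norm-1-q^3m+2 : ∀ m → norm (oneˢ - q ^ (2 ℕ.+ 3 ℕ.* m)) ≋ oneˢ - q ^ (2 ℕ.+ 3 ℕ.* m)
norm-1-q^3m+2 m = begin
  norm (oneˢ - q * (q * q ^ (3 ℕ.* m)))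
    ≈⟨ norm-cong (trans (solve 2 (λ q y → :1 :- q :* (q :* y)
           := :1 :+ q :* con (+ 0) :+ q :* (q :* (:- y)))
           refl q (q ^ (3 ℕ.* m)))
         (+-cong (+-cong (sym (dil-one 3)) (*-congˡ (sym (dil-const 3 (+ 0)))))
           (*-congˡ (*-congˡ (sym (trans (dil-neg 3 _) (-‿cong (dil-q^ 3 m)))))))) ⟩
  norm (tri oneˢ zeroˢ (-ˢ (q ^ m)))
    ≈⟨ norm-tri _ _ _ ⟩
  norm₃ oneˢ zeroˢ (-ˢ (q ^ m))
    ≈⟨ solve 2 (λ q x → :1 :^ 3 :+ q :* con (+ 0) :^ 3 :+ q :* (q :* (:- x) :^ 3)
         :+ con (- + 3) :* (q :* (:1 :* (con (+ 0) :* (:- x)))) := :1 :- q :* (q :* x :^ 3)) refl q (q ^ m) ⟩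
  oneˢ - q * (q * (q ^ m) ^ 3)
    ≈⟨ +-congˡ (-‿cong (*-congˡ (*-congˡ (q^3 m)))) ⟩
  oneˢ - q * (q * q ^ (3 ℕ.* m)) ∎

dil-1-q^ : ∀ k .{{_ : NonZero k}} m → dil k (oneˢ - q ^ m) ≋ oneˢ - q ^ (k ℕ.* m)
dil-1-q^ k m = trans (dil-+ k _ _) (+-cong (dil-one k) (trans (dil-neg k _) (-‿cong (dil-q^ k m))))

dil-Eprod-suc : ∀ k .{{_ : NonZero k}} m → dil k (Eprod (suc m)) ≋ dil k (Eprod m) * (oneˢ - q ^ (k ℕ.* suc m))
dil-Eprod-suc k m = trans (dil-cong k (Eprod-suc m)) (trans (dil-* k _ _) (*-congˡ (dil-1-q^ k (suc m))))

-- The norm fixes the factors 1 - q^k with k prime to 3 and sends 1 - q^(3l) to (1 - q^l)³.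
-- Multiplying by `dil 3 (Eprod m)` restores the replaced factors, so no division occurs.
norm-Eprod : ∀ m → norm (Eprod (3 ℕ.* m)) * dil 3 (Eprod m) ≋ Eprod (3 ℕ.* m) * Eprod m ^ 3
norm-Eprod zero = trans (*-cong (trans (norm-cong (sym (dil-one 3))) (norm-dil₃ oneˢ)) (dil-one 3))
  (solve 0 (:1 :^ 3 :* :1 := :1 :* :1 :^ 3) refl)
norm-Eprod (suc m) = begin
  norm (Eprod (3 ℕ.* suc m)) * dil 3 (Eprod (suc m))
    ≈⟨ *-cong (norm-cong Eprod-3) (dil-Eprod-suc 3 m) ⟩
  norm (e * a * b * c) * (dil 3 (Eprod m) * c)
    ≈⟨ *-congʳ (trans (norm-* _ _) (*-cong (trans (norm-* _ _) (*-cong (trans (norm-* _ _)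
         (*-congˡ (norm-1-q^3m+1 m))) (norm-1-q^3m+2 m)))
         (trans (norm-cong (sym (dil-1-q^ 3 (suc m)))) (norm-dil₃ d)))) ⟩
  norm e * a * b * d ^ 3 * (dil 3 (Eprod m) * c)
    ≈⟨ solve 6 (λ n a b d e c → n :* a :* b :* d :^ 3 :* (e :* c) := n :* e :* (a :* b :* c :* d :^ 3)) refl
         (norm e) a b d (dil 3 (Eprod m)) c ⟩
  norm e * dil 3 (Eprod m) * (a * b * c * d ^ 3)
    ≈⟨ *-congʳ (norm-Eprod m) ⟩
  e * Eprod m ^ 3 * (a * b * c * d ^ 3)
    ≈⟨ solve 6 (λ e f a b c d → e :* f :^ 3 :* (a :* b :* c :* d :^ 3) := e :* a :* b :* c :* (f :* d) :^ 3) refl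
         e (Eprod m) a b c d ⟩
  e * a * b * c * (Eprod m * d) ^ 3
    ≈⟨ *-cong Eprod-3 (^-cong 3 (Eprod-suc m)) ⟨
  Eprod (3 ℕ.* suc m) * Eprod (suc m) ^ 3 ∎
  where
  e = Eprod (3 ℕ.* m)
  a = oneˢ - q ^ (1 ℕ.+ 3 ℕ.* m)
  b = oneˢ - q ^ (2 ℕ.+ 3 ℕ.* m)
  c = oneˢ - q ^ (3 ℕ.* suc m)
  d = oneˢ - q ^ suc m
  Eprod-3 : Eprod (3 ℕ.* suc m) ≋ e * a * b * c
  Eprod-3 = ≡.subst (λ k → Eprod k ≋ e * a * b * (oneˢ - q ^ k)) (≡.sym (ℕₚ.*-suc 3 m))
    (trans (Eprod-suc (2 ℕ.+ 3 ℕ.* m)) (*-congʳ (trans (Eprod-suc (1 ℕ.+ 3 ℕ.* m)) (*-congʳ (Eprod-suc (3 ℕ.* m))))))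

norm-E : norm E * dil 3 E ≋ E ^ 4
norm-E = ≈⇒≋ λ m → ≈-trans
  (≈-* (≈-sym (norm-≈ (≈-weaken (ℕₚ.n≤1+n _) (Eprod-≈ (3 ℕ.* m)))))
       (≈-sym (dil-≈ 3 (≈-weaken (ℕₚ.n≤1+n m) (Eprod-≈ m)))))
  (≈-trans (≋⇒≈ (norm-Eprod m))
    (≈-* (≈-weaken (ℕₚ.≤-trans (ℕₚ.m≤n*m m 3) (ℕₚ.n≤1+n _)) (Eprod-≈ (3 ℕ.* m)))
         (≈-^ 3 (≈-weaken (ℕₚ.n≤1+n m) (Eprod-≈ m)))))

-- Sums over antidiagonals

anti : ℕ → (ℕ → ℕ → PS) → PS
anti zero    F = F 0 0
anti (suc N) F = F 0 (suc N) + anti N (λ i j → F (suc i) j)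

anti-cong : ∀ N {F G} → (∀ i j → i ℕ.+ j ≡ N → F i j ≋ G i j) → anti N F ≋ anti N G
anti-cong zero    h = h 0 0 ≡.refl
anti-cong (suc N) h = +-cong (h 0 (suc N) ≡.refl) (anti-cong N (λ i j e → h (suc i) j (cong suc e)))

anti-≈ : ∀ N {M F G} → (∀ i j → i ℕ.+ j ≡ N → F i j ≈[ M ] G i j) → anti N F ≈[ M ] anti N G
anti-≈ zero    h = h 0 0 ≡.refl
anti-≈ (suc N) h = ≈-+ (h 0 (suc N) ≡.refl) (anti-≈ N (λ i j e → h (suc i) j (cong suc e)))

anti-+ : ∀ N F G → anti N (λ i j → F i j + G i j) ≋ anti N F + anti N G
anti-+ zero    F G = refl
anti-+ (suc N) F G = trans (+-congˡ (anti-+ N _ _))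
  (solve 4 (λ a b c d → (a :+ b) :+ (c :+ d) := (a :+ c) :+ (b :+ d)) refl _ _ _ _)

anti-* : ∀ N c F → anti N (λ i j → c * F i j) ≋ c * anti N F
anti-* zero    c F = refl
anti-* (suc N) c F = trans (+-congˡ (anti-* N c _))
  (solve 3 (λ c a b → c :* a :+ c :* b := c :* (a :+ b)) refl c _ _)

anti-last : ∀ N F → anti (suc N) F ≋ anti N (λ i j → F i (suc j)) + F (suc N) 0
anti-last zero    F = refl
anti-last (suc N) F = trans (+-congˡ (anti-last N (λ i j → F (suc i) j)))
  (solve 3 (λ a b c → a :+ (b :+ c) := (a :+ b) :+ c) refl _ _ _)

-- The summation step shared by both q-Pascal rules: an interior point has two predecessors, a point
-- on an edge of the triangle only one.
anti-pascal : ∀ N F G H → (∀ j → F 0 (suc j) ≋ G 0 j) → (∀ i → F (suc i) 0 ≋ H i 0) →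
              (∀ i j → F (suc i) (suc j) ≋ G (suc i) j + H i (suc j)) →
              anti (suc N) F ≋ anti N G + anti N H
anti-pascal N F G H hˡ hʳ h = begin
  anti (suc N) F                                 ≈⟨ anti-cong (suc N) split ⟩
  anti (suc N) (λ i j → G⁺ i j + H⁺ i j)         ≈⟨ anti-+ (suc N) G⁺ H⁺ ⟩
  anti (suc N) G⁺ + anti (suc N) H⁺              ≈⟨ +-congʳ (anti-last N G⁺) ⟩
  (anti N G + zeroˢ) + (zeroˢ + anti N H)        ≈⟨ +-cong (+-identityʳ _) (+-identityˡ _) ⟩
  anti N G + anti N H                            ∎
  where
  -- Extending by zero at the missing predecessor turns the three cases into one identity on the
  -- whole antidiagonal.
  G⁺ H⁺ : ℕ → ℕ → PS
  G⁺ i zero    = zeroˢ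
  G⁺ i (suc j) = G i j
  H⁺ zero    j = zeroˢ
  H⁺ (suc i) j = H i j
  split : ∀ i j → i ℕ.+ j ≡ suc N → F i j ≋ G⁺ i j + H⁺ i j
  split zero    (suc j) _ = trans (hˡ j) (sym (+-identityʳ _))
  split (suc i) zero    _ = trans (hʳ i) (sym (+-identityˡ _))
  split (suc i) (suc j) _ = h i j

-- Gaussian binomial coefficients

binom : ℕ → ℕ → PS
binom i j = Eprod (i ℕ.+ j) * inv (Eprod i) * inv (Eprod j)

Eprod-inverse : ∀ i → Eprod i * inv (Eprod i) ≋ oneˢ
Eprod-inverse i = inv-inverseʳ (Eprod i) (Eprod-head i)

binom-0ˡ : ∀ j → binom 0 j ≋ oneˢ
binom-0ˡ j = begin
  Eprod j * inv oneˢ * inv (Eprod j)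
    ≈⟨ solve 3 (λ e o v → e :* o :* v := (:1 :* o) :* (e :* v)) refl (Eprod j) (inv oneˢ) (inv (Eprod j)) ⟩
  (oneˢ * inv oneˢ) * (Eprod j * inv (Eprod j)) ≈⟨ *-cong (Eprod-inverse 0) (Eprod-inverse j) ⟩
  oneˢ * oneˢ ≈⟨ *-identityˡ oneˢ ⟩
  oneˢ ∎

binom-0ʳ : ∀ i → binom i 0 ≋ oneˢ
binom-0ʳ i = begin
  Eprod (i ℕ.+ 0) * inv (Eprod i) * inv oneˢ
    ≡⟨ cong (λ k → Eprod k * inv (Eprod i) * inv oneˢ) (ℕₚ.+-identityʳ i) ⟩
  Eprod i * inv (Eprod i) * inv oneˢ
    ≈⟨ *-cong (Eprod-inverse i) (trans (sym (*-identityˡ _)) (Eprod-inverse 0)) ⟩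
  oneˢ * oneˢ ≈⟨ *-identityˡ oneˢ ⟩
  oneˢ ∎

inv-Eprod : ∀ i → inv (Eprod i) ≋ (oneˢ - q ^ suc i) * inv (Eprod (suc i))
inv-Eprod i = *-cancelˡ (Eprod i) (Eprod-head i) (begin
  Eprod i * inv (Eprod i)                                       ≈⟨ Eprod-inverse i ⟩
  oneˢ                                                          ≈⟨ Eprod-inverse (suc i) ⟨
  Eprod (suc i) * inv (Eprod (suc i))                           ≈⟨ *-congʳ (Eprod-suc i) ⟩
  Eprod i * (oneˢ - q ^ suc i) * inv (Eprod (suc i))            ≈⟨ *-assoc _ _ _ ⟩
  Eprod i * ((oneˢ - q ^ suc i) * inv (Eprod (suc i)))          ∎)

module _ (i j : ℕ) where
  private
    e = Eprod (i ℕ.+ suc j)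
    x = q ^ suc i
    y = q ^ suc j
    u = inv (Eprod (suc i))
    v = inv (Eprod (suc j))

    both : binom (suc i) (suc j) ≋ e * (oneˢ - x * y) * u * v
    both = *-congʳ (*-congʳ (trans (Eprod-suc (i ℕ.+ suc j))
      (*-congˡ (+-congˡ (-‿cong (^-+ q (suc i) (suc j)))))))

    left : binom i (suc j) ≋ e * ((oneˢ - x) * u) * v
    left = *-congʳ (*-congˡ (inv-Eprod i))

    right : binom (suc i) j ≋ e * u * ((oneˢ - y) * v)
    right = trans (*-congˡ (inv-Eprod j))
      (mk λ n → cong (λ k → (Eprod k * u * ((oneˢ - y) * v)) n) (≡.sym (ℕₚ.+-suc i j)))

  -- With x = q^(i+1) and y = q^(j+1) this is 1 - xy = (1 - y) + y(1 - x); the other rule exchanges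
  -- x and y.
  binom-pascalˡ : binom (suc i) (suc j) ≋ binom (suc i) j + q ^ suc j * binom i (suc j)
  binom-pascalˡ = trans both (trans
    (solve 5 (λ e x y u v → e :* (:1 :- x :* y) :* u :* v
      := e :* u :* ((:1 :- y) :* v) :+ y :* (e :* ((:1 :- x) :* u) :* v)) refl e x y u v)
    (sym (+-cong right (*-congˡ left))))

  binom-pascalʳ : binom (suc i) (suc j) ≋ binom i (suc j) + q ^ suc i * binom (suc i) j
  binom-pascalʳ = trans both (trans
    (solve 5 (λ e x y u v → e :* (:1 :- x :* y) :* u :* v
      := e :* ((:1 :- x) :* u) :* v :+ x :* (e :* u :* ((:1 :- y) :* v))) refl e x y u v)
    (sym (+-cong left (*-congˡ right))))

-- Up to q^k all three finite products are E, so the quotient is 1/E.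
binom-≈ : ∀ {k} i j → k ≤ i → k ≤ j → binom i j * E ≈[ k ] oneˢ
binom-≈ {k} i j k≤i k≤j = ≈-trans
  (≈-* (≈-* (≈-* (≈-trans E-i+j (≈-sym (E-≈ i k≤i))) ≈-refl) ≈-refl) (≈-sym (E-≈ j k≤j)))
  (≋⇒≈ (begin
    Eprod i * inv (Eprod i) * inv (Eprod j) * Eprod j
      ≈⟨ solve 4 (λ a b c d → a :* b :* c :* d := (a :* b) :* (d :* c)) refl
           (Eprod i) (inv (Eprod i)) (inv (Eprod j)) (Eprod j) ⟩
    (Eprod i * inv (Eprod i)) * (Eprod j * inv (Eprod j))
      ≈⟨ *-cong (Eprod-inverse i) (Eprod-inverse j) ⟩
    oneˢ * oneˢ
      ≈⟨ *-identityˡ oneˢ ⟩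
    oneˢ ∎))
  where
  E-≈ : ∀ m → k ≤ m → Eprod m ≈[ k ] E
  E-≈ m k≤m = ≈-weaken (ℕₚ.m≤n⇒m≤1+n k≤m) (Eprod-≈ m)
  E-i+j = E-≈ (i ℕ.+ j) (ℕₚ.≤-trans k≤i (ℕₚ.m≤m+n i j))

B : ℕ → ℕ → PS
B i j = dil 2 (binom i j)

B-0ˡ : ∀ j → B 0 j ≋ oneˢ
B-0ˡ j = trans (dil-cong 2 (binom-0ˡ j)) (dil-one 2)

B-0ʳ : ∀ i → B i 0 ≋ oneˢ
B-0ʳ i = trans (dil-cong 2 (binom-0ʳ i)) (dil-one 2)

B-pascalˡ : ∀ i j → B (suc i) (suc j) ≋ B (suc i) j + q ^ (2 ℕ.* suc j) * B i (suc j)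
B-pascalˡ i j = trans (dil-cong 2 (binom-pascalˡ i j)) (trans (dil-+ 2 _ _) (+-congˡ (dil-q^* 2 (suc j) _)))

B-pascalʳ : ∀ i j → B (suc i) (suc j) ≋ B i (suc j) + q ^ (2 ℕ.* suc i) * B (suc i) j
B-pascalʳ i j = trans (dil-cong 2 (binom-pascalʳ i j)) (trans (dil-+ 2 _ _) (+-congˡ (dil-q^* 2 (suc i) _)))

B-≈ : ∀ {k} i j → k ≤ i → k ≤ j → B i j * dil 2 E ≈[ k ] oneˢ
B-≈ i j k≤i k≤j = ≈-resp (sym (dil-* 2 (binom i j) E)) (sym (dil-one 2)) (dil-≈ 2 (binom-≈ i j k≤i k≤j))

-- A finite form of Gauss's identity

-- s k = (-1)^k q^(k²)
s : ℕ → PS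
s zero    = oneˢ
s (suc k) = -ˢ (q ^ (1 ℕ.+ 2 ℕ.* k) * s k)

-- w i m = s ∣ i - m ∣
w : ℕ → ℕ → PS
w i       zero    = s i
w zero    (suc m) = s (suc m)
w (suc i) (suc m) = w i m

w-0 : ∀ m → w 0 m ≡ s m
w-0 zero    = ≡.refl
w-0 (suc m) = ≡.refl

w-+ : ∀ k n → w (k ℕ.+ n) n ≡ s k
w-+ k zero    = cong s (ℕₚ.+-identityʳ k)
w-+ k (suc n) = ≡.trans (cong (λ i → w i (suc n)) (ℕₚ.+-suc k n)) (w-+ k n)

q^-≡ : ∀ {m n} → m ≡ n → q ^ m ≋ q ^ n
q^-≡ e = mk λ n → cong (λ k → (q ^ k) n) e

q^2-+ : ∀ a b → q ^ (2 ℕ.* (a ℕ.+ b)) ≋ q ^ (2 ℕ.* a) * q ^ (2 ℕ.* b)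
q^2-+ a b = trans (q^-≡ (ℕₚ.*-distribˡ-+ 2 a b)) (^-+ q (2 ℕ.* a) (2 ℕ.* b))

q^2-suc : ∀ a → q ^ (2 ℕ.* suc a) ≋ q * (q * q ^ (2 ℕ.* a))
q^2-suc a = q^-≡ (ℕₚ.*-suc 2 a)

-- If i + j = m + n, then (i + 1 - m)² + 2j = (i - m)² + 2n + 1, and the sign changes once. The
-- factor produced does not depend on the position (i, j) on the antidiagonal.
w-stepˡ : ∀ i m j n → i ℕ.+ j ≡ m ℕ.+ n → w (suc i) m * q ^ (2 ℕ.* j) ≋ -ˢ (q ^ (1 ℕ.+ 2 ℕ.* n)) * w i m
w-stepˡ zero zero j .j ≡.refl =
  solve 2 (λ q y → :- (q :* :1 :* :1) :* y := :- (q :* y) :* :1) refl q (q ^ (2 ℕ.* j))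
w-stepˡ zero (suc m) .(suc m ℕ.+ n) n ≡.refl = begin
  w 0 m * q ^ (2 ℕ.* (suc m ℕ.+ n))
    ≈⟨ *-cong (mk λ k → cong (λ f → f k) (w-0 m)) (trans (q^2-+ (suc m) n) (*-congʳ (q^2-suc m))) ⟩
  s m * (q * (q * q ^ (2 ℕ.* m)) * q ^ (2 ℕ.* n))
    ≈⟨ solve 4 (λ q s x y → s :* (q :* (q :* x) :* y) := :- (q :* y) :* :- (q :* x :* s)) refl
         q (s m) (q ^ (2 ℕ.* m)) (q ^ (2 ℕ.* n)) ⟩
  -ˢ (q * q ^ (2 ℕ.* n)) * -ˢ (q * q ^ (2 ℕ.* m) * s m) ∎
w-stepˡ (suc i) zero j .(suc i ℕ.+ j) ≡.refl = trans
  (solve 4 (λ q x s y → :- (q :* x :* s) :* y := :- (q :* (x :* y)) :* s) refl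
    q (q ^ (2 ℕ.* suc i)) (s (suc i)) (q ^ (2 ℕ.* j)))
  (*-congʳ (-‿cong (*-congˡ (sym (q^2-+ (suc i) j)))))
w-stepˡ (suc i) (suc m) j n e = w-stepˡ i m j n (ℕₚ.suc-injective e)

-- Here the exponents satisfy (i - m - 1)² + 2i = (i - m)² + 2m + 1.
w-stepʳ : ∀ i m → w i (suc m) * q ^ (2 ℕ.* i) ≋ -ˢ (q ^ (1 ℕ.+ 2 ℕ.* m)) * w i m
w-stepʳ zero m = trans
  (solve 3 (λ q x s → :- (q :* x :* s) :* :1 := :- (q :* x) :* s) refl q (q ^ (2 ℕ.* m)) (s m))
  (*-congˡ (mk λ k → cong (λ f → f k) (≡.sym (w-0 m))))
w-stepʳ (suc i) zero = trans (*-congˡ (q^2-suc i))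
  (solve 3 (λ q x s → s :* (q :* (q :* x)) := :- (q :* :1) :* :- (q :* x :* s)) refl q (q ^ (2 ℕ.* i)) (s i))
w-stepʳ (suc i) (suc m) = begin
  w i (suc m) * q ^ (2 ℕ.* suc i)
    ≈⟨ *-congˡ (q^2-suc i) ⟩
  w i (suc m) * (q * (q * q ^ (2 ℕ.* i)))
    ≈⟨ solve 3 (λ q w x → w :* (q :* (q :* x)) := q :* (q :* (w :* x))) refl q (w i (suc m)) (q ^ (2 ℕ.* i)) ⟩
  q * (q * (w i (suc m) * q ^ (2 ℕ.* i)))
    ≈⟨ *-congˡ (*-congˡ (w-stepʳ i m)) ⟩
  q * (q * (-ˢ (q * q ^ (2 ℕ.* m)) * w i m))
    ≈⟨ solve 3 (λ q y w → q :* (q :* (:- (q :* y) :* w)) := :- (q :* (q :* (q :* y))) :* w) refl q (q ^ (2 ℕ.* m)) (w i m) ⟩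
  -ˢ (q * (q * (q * q ^ (2 ℕ.* m)))) * w i m
    ≈⟨ *-congʳ (-‿cong (*-congˡ (q^2-suc m))) ⟨
  -ˢ (q * q ^ (2 ℕ.* suc m)) * w i m ∎

odd : ℕ → PS
odd zero    = oneˢ
odd (suc n) = odd n * (oneˢ - q ^ (1 ℕ.+ 2 ℕ.* n))

wB : ℕ → ℕ → PS
wB N m = anti N (λ i j → w i m * B i j)

-- The Pascal rule yields the old sum and one with shifted weights and an extra q^(2j). By `w-stepˡ`
-- shift and power combine to the constant -q^(2n+1), so the second sum is a multiple of the first.
wB-stepˡ : ∀ m n → wB (m ℕ.+ suc n) m ≋ wB (m ℕ.+ n) m * (oneˢ - q ^ (1 ℕ.+ 2 ℕ.* n))
wB-stepˡ m n = begin
  wB (m ℕ.+ suc n) m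
    ≡⟨ cong (λ N → wB N m) (ℕₚ.+-suc m n) ⟩
  wB (suc (m ℕ.+ n)) m
    ≈⟨ anti-pascal (m ℕ.+ n) (λ i j → w i m * B i j) (λ i j → w i m * B i j) (λ i j → w (suc i) m * (q ^ (2 ℕ.* j) * B i j))
         (λ j → *-congˡ (trans (B-0ˡ (suc j)) (sym (B-0ˡ j))))
         (λ i → *-congˡ (trans (B-0ʳ (suc i)) (sym (trans (*-identityˡ _) (B-0ʳ i)))))
         (λ i j → trans (*-congˡ (B-pascalˡ i j))
           (solve 3 (λ a b c → a :* (b :+ c) := a :* b :+ a :* c) refl _ _ _)) ⟩
  wB (m ℕ.+ n) m + anti (m ℕ.+ n) (λ i j → w (suc i) m * (q ^ (2 ℕ.* j) * B i j))
    ≈⟨ +-congˡ (anti-cong (m ℕ.+ n) (λ i j e → trans (sym (*-assoc _ _ _))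
         (trans (*-congʳ (w-stepˡ i m j n e)) (*-assoc _ _ _)))) ⟩
  wB (m ℕ.+ n) m + anti (m ℕ.+ n) (λ i j → -ˢ c * (w i m * B i j))
    ≈⟨ +-congˡ (anti-* (m ℕ.+ n) (-ˢ c) _) ⟩
  wB (m ℕ.+ n) m + -ˢ c * wB (m ℕ.+ n) m
    ≈⟨ solve 2 (λ f c → f :+ :- c :* f := f :* (:1 :- c)) refl _ c ⟩
  wB (m ℕ.+ n) m * (oneˢ - c) ∎
  where
  c = q ^ (1 ℕ.+ 2 ℕ.* n)

wB-stepʳ : ∀ N m → wB (suc N) (suc m) ≋ wB N m * (oneˢ - q ^ (1 ℕ.+ 2 ℕ.* m))
wB-stepʳ N m = begin
  wB (suc N) (suc m)
    ≈⟨ anti-pascal N (λ i j → w i (suc m) * B i j) (λ i j → w i (suc m) * (q ^ (2 ℕ.* i) * B i j)) (λ i j → w i m * B i j)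
         (λ j → *-congˡ (trans (B-0ˡ (suc j)) (sym (trans (*-identityˡ _) (B-0ˡ j)))))
         (λ i → *-congˡ (trans (B-0ʳ (suc i)) (sym (B-0ʳ i))))
         (λ i j → trans (*-congˡ (B-pascalʳ i j))
           (solve 3 (λ a b c → a :* (b :+ c) := a :* c :+ a :* b) refl _ _ _)) ⟩
  anti N (λ i j → w i (suc m) * (q ^ (2 ℕ.* i) * B i j)) + wB N m
    ≈⟨ +-congʳ (anti-cong N (λ i j _ → trans (sym (*-assoc _ _ _))
         (trans (*-congʳ (w-stepʳ i m)) (*-assoc _ _ _)))) ⟩
  anti N (λ i j → -ˢ c * (w i m * B i j)) + wB N m
    ≈⟨ +-congʳ (anti-* N (-ˢ c) _) ⟩
  -ˢ c * wB N m + wB N m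
    ≈⟨ solve 2 (λ f c → :- c :* f :+ f := f :* (:1 :- c)) refl _ c ⟩
  wB N m * (oneˢ - c) ∎
  where
  c = q ^ (1 ℕ.+ 2 ℕ.* m)

wB-odd : ∀ m n → wB (m ℕ.+ n) m ≋ odd m * odd n
wB-odd zero    zero    = *-congˡ (B-0ˡ 0)
wB-odd (suc m) zero    = trans (wB-stepʳ (m ℕ.+ 0) m) (trans (*-congʳ (wB-odd m 0))
  (solve 2 (λ o c → o :* :1 :* c := o :* c :* :1) refl (odd m) _))
wB-odd m       (suc n) = trans (wB-stepˡ m n) (trans (*-congʳ (wB-odd m n)) (*-assoc _ _ _))

odd-Eprod : ∀ n → odd n * dil 2 (Eprod n) ≋ Eprod (2 ℕ.* n)
odd-Eprod zero    = trans (*-congˡ (dil-one 2)) (*-identityˡ oneˢ)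
odd-Eprod (suc n) = begin
  odd n * a * dil 2 (Eprod (suc n))
    ≈⟨ *-congˡ (dil-Eprod-suc 2 n) ⟩
  odd n * a * (dil 2 (Eprod n) * b)
    ≈⟨ solve 4 (λ o a d b → o :* a :* (d :* b) := o :* d :* a :* b) refl (odd n) a (dil 2 (Eprod n)) b ⟩
  odd n * dil 2 (Eprod n) * a * b
    ≈⟨ *-congʳ (*-congʳ (odd-Eprod n)) ⟩
  Eprod (2 ℕ.* n) * a * b
    ≈⟨ ≡.subst (λ k → Eprod k ≋ Eprod (2 ℕ.* n) * a * (oneˢ - q ^ k)) (≡.sym (ℕₚ.*-suc 2 n))
         (trans (Eprod-suc (1 ℕ.+ 2 ℕ.* n)) (*-congʳ (Eprod-suc (2 ℕ.* n)))) ⟨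
  Eprod (2 ℕ.* suc n) ∎
  where
  a = oneˢ - q ^ (1 ℕ.+ 2 ℕ.* n)
  b = oneˢ - q ^ (2 ℕ.* suc n)

odd-≈ : ∀ n → odd n * dil 2 E ≈[ n ] E
odd-≈ n = ≈-trans (≈-* ≈-refl (dil-≈ 2 (≈-sym (≈-weaken (ℕₚ.n≤1+n n) (Eprod-≈ n)))))
  (≈-trans (≋⇒≈ (odd-Eprod n)) (≈-weaken (ℕₚ.≤-trans (ℕₚ.m≤n*m n 2) (ℕₚ.n≤1+n _)) (Eprod-≈ (2 ℕ.* n))))

-- The exponent k² is weakened to k, which already suffices for the estimate in `wB-≈` and keeps it
-- linear.
s-divisible : ∀ k → ∃[ u ] s k ≋ q ^ k * u
s-divisible zero    = oneˢ , sym (*-identityˡ oneˢ)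
s-divisible (suc k) with s-divisible k
... | u , p = -ˢ (q ^ (2 ℕ.* k) * u) , trans (-‿cong (*-congˡ p))
  (solve 4 (λ q x y u → :- (q :* x :* (y :* u)) := q :* y :* :- (x :* u)) refl q (q ^ (2 ℕ.* k)) (q ^ k) u)

w-divisible : ∀ i m → ∃[ u ] w i m ≋ q ^ ∣ i - m ∣ * u
w-divisible zero    zero    = s-divisible 0
w-divisible (suc i) zero    = s-divisible (suc i)
w-divisible zero    (suc m) = s-divisible (suc m)
w-divisible (suc i) (suc m) = w-divisible i m

-- `B i j` is close to 1/E(q²) only up to q^min(i,j), which is poor near the ends of the
-- antidiagonal. There the weight helps: it is divisible by q^d with d = |i - n|, and both d + i and
-- d + j are at least n.
wB-≈ : ∀ i j n → i ℕ.+ j ≡ n ℕ.+ n → w i n * B i j * dil 2 E ≈[ n ] w i n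
wB-≈ i j n i+j≡2n with w-divisible i n
... | u , p = ≈-resp
  (trans (*-congʳ (*-congʳ p)) (solve 4 (λ x u b e → x :* u :* b :* e := x :* (u :* (b :* e))) refl (q ^ d) u (B i j) (dil 2 E)))
  (trans p (solve 2 (λ x u → x :* u := x :* (u :* :1)) refl (q ^ d) u))
  (≈-weaken (ℕₚ.m≤n+m∸n n d) (≈-q^ d (≈-* (≈-refl {f = u}) (B-≈ i j
    (ℕₚ.m≤n+o⇒m∸n≤o n d n≤d+i) (ℕₚ.m≤n+o⇒m∸n≤o n d n≤d+j)))))
  where
  d = ∣ i - n ∣
  n≤d+i : n ≤ d ℕ.+ i
  n≤d+i = ≡.subst (n ≤_) (ℕₚ.+-comm i d) (ℕₚ.m≤n+∣n-m∣ n i)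
  n≤d+j : n ≤ d ℕ.+ j
  n≤d+j = ℕₚ.+-cancelˡ-≤ n n (d ℕ.+ j) (ℕₚ.≤-trans (ℕₚ.≤-reflexive (≡.sym i+j≡2n))
    (ℕₚ.≤-trans (ℕₚ.+-monoˡ-≤ j (ℕₚ.m≤n+∣m-n∣ i n)) (ℕₚ.≤-reflexive (ℕₚ.+-assoc n d j))))

-- The central case m = n and its limit, Gauss's identity

θ : ℕ → PS
θ zero    = oneˢ
θ (suc n) = θ n + const (+ 2) * s (suc n)

-- The offset i - n runs from -n to n. Passing to n + 1 adds one equal term at each end, whence the
-- 2 in `θ`.
anti-w : ∀ n → anti (n ℕ.+ n) (λ i _ → w i n) ≋ θ n
anti-w zero    = refl
anti-w (suc n) = begin
  s (suc n) + anti (n ℕ.+ suc n) (λ i _ → w i n)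
    ≡⟨ cong (λ N → s (suc n) + anti N (λ i _ → w i n)) (ℕₚ.+-suc n n) ⟩
  s (suc n) + anti (suc (n ℕ.+ n)) (λ i _ → w i n)
    ≈⟨ +-congˡ (anti-last (n ℕ.+ n) (λ i _ → w i n)) ⟩
  s (suc n) + (anti (n ℕ.+ n) (λ i _ → w i n) + w (suc n ℕ.+ n) n)
    ≈⟨ +-congˡ (+-cong (anti-w n) (mk λ k → cong (λ f → f k) (w-+ (suc n) n))) ⟩
  s (suc n) + (θ n + s (suc n))
    ≈⟨ solve 2 (λ s t → s :+ (t :+ s) := t :+ con (+ 2) :* s) refl (s (suc n)) (θ n) ⟩
  θ n + const (+ 2) * s (suc n) ∎

-- G = φ(-q)
G : PS
G = E ^ 2 * inv (dil 2 E)

dil₂E-head : dil 2 E 0 ≡ + 1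
dil₂E-head = dil-head 2 E

G-E : G * dil 2 E ≋ E ^ 2
G-E = begin
  E ^ 2 * inv (dil 2 E) * dil 2 E    ≈⟨ solve 3 (λ a b c → a :* b :* c := a :* (c :* b)) refl (E ^ 2) (inv (dil 2 E)) (dil 2 E) ⟩
  E ^ 2 * (dil 2 E * inv (dil 2 E))  ≈⟨ *-congˡ (inv-inverseʳ (dil 2 E) dil₂E-head) ⟩
  E ^ 2 * oneˢ                       ≈⟨ *-identityʳ _ ⟩
  E ^ 2                              ∎

-- One factor E(q²) clears the binomials from the finite identity for m = n and leaves `θ n` against
-- `odd n * odd n * dil 2 E`; a second one completes the square of `odd n * dil 2 E`, which tends to
-- E.
gauss : ∀ n → G ≈[ n ] θ n
gauss n = ≈-sym (≈-trans (≋⇒≈ expand) (≈-* θE≈E² ≈-refl))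
  where
  expand : θ n ≋ θ n * dil 2 E * inv (dil 2 E)
  expand = sym (trans (*-assoc _ _ _) (trans (*-congˡ (inv-inverseʳ (dil 2 E) dil₂E-head)) (*-identityʳ _)))
  θ≈odd² : θ n ≈[ n ] odd n * odd n * dil 2 E
  θ≈odd² = ≈-trans (≋⇒≈ (sym (anti-w n))) (≈-trans
    (≈-sym (anti-≈ (n ℕ.+ n) (λ i j e → ≈-trans (≋⇒≈ (*-comm (dil 2 E) (w i n * B i j))) (wB-≈ i j n e))))
    (≋⇒≈ (trans (anti-* (n ℕ.+ n) (dil 2 E) _) (trans (*-congˡ (wB-odd n n)) (*-comm _ _)))))
  θE≈E² : θ n * dil 2 E ≈[ n ] E ^ 2
  θE≈E² = ≈-trans (≈-* θ≈odd² ≈-refl) (≈-trans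
    (≋⇒≈ (solve 2 (λ o e → o :* o :* e :* e := (o :* e) :^ 2) refl (odd n) (dil 2 E)))
    (≈-^ 2 (odd-≈ n)))

-- Trisection of G

module _ (m : ℕ) where
  private
    x = q ^ (2 ℕ.* m)
    y = q ^ (2 ℕ.* (3 ℕ.* m))

    dil₃x : dil 3 x ≋ y
    dil₃x = trans (dil-q^ 3 (2 ℕ.* m)) (q^-≡ (exponent m))
      where
      exponent : ∀ m → 3 ℕ.* (2 ℕ.* m) ≡ 2 ℕ.* (3 ℕ.* m)
      exponent = ℕ-Solver.solve-∀

    dil₃y : dil 3 y ≋ y ^ 3
    dil₃y = trans (dil-q^ 3 (2 ℕ.* (3 ℕ.* m))) (sym (q^3 (2 ℕ.* (3 ℕ.* m))))

    q^-1 : q ^ (1 ℕ.+ 2 ℕ.* (1 ℕ.+ 3 ℕ.* m)) ≋ q ^ 3 * y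
    q^-1 = trans (*-congˡ (q^2-suc (3 ℕ.* m))) (solve 2 (λ q y → q :* (q :* (q :* y)) := q :^ 3 :* y) refl q y)

    q^-2 : q ^ (1 ℕ.+ 2 ℕ.* (2 ℕ.+ 3 ℕ.* m)) ≋ q ^ 5 * y
    q^-2 = trans (*-congˡ (trans (q^2-suc (1 ℕ.+ 3 ℕ.* m)) (*-congˡ (*-congˡ (q^2-suc (3 ℕ.* m))))))
      (solve 2 (λ q y → q :* (q :* (q :* (q :* (q :* y)))) := q :^ 5 :* y) refl q y)

    dil₃-q* : ∀ h → dil 3 (q * h) ≋ q ^ 3 * dil 3 h
    dil₃-q* h = trans (dil-* 3 q h) (*-congʳ (dil-q 3))

    t = dil 3 (dil 3 (s m))

    -- Read off from (3m+1)² = 1 + 3(3m² + 2m) and (3m+2)² = 1 + 3(3m² + 4m + 1); the q^(3m²) and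
    -- the sign (-1)^m are in `dil 3 (s m)`.
    c₁ c₂ : PS
    c₁ = -ˢ (x * dil 3 (s m))
    c₂ = q * (x * (x * dil 3 (s m)))

  -- The parameter is an induction hypothesis: `s` recurses one index at a time, so the step from 3m
  -- to 3m + 3 passes through both intermediate terms.
  module _ (s-3m : s (3 ℕ.* m) ≋ t) where
    private
      s₁ : s (1 ℕ.+ 3 ℕ.* m) ≋ -ˢ (q * y * t)
      s₁ = -‿cong (*-congˡ s-3m)

      s₂ : s (2 ℕ.+ 3 ℕ.* m) ≋ q ^ 4 * y ^ 2 * t
      s₂ = trans (-‿cong (*-cong q^-1 s₁))
        (solve 3 (λ q y t → :- (q :^ 3 :* y :* :- (q :* y :* t)) := q :^ 4 :* y :^ 2 :* t) refl q y t)

      s₃ : s (3 ℕ.+ 3 ℕ.* m) ≋ -ˢ (q ^ 9 * y ^ 3 * t)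
      s₃ = trans (-‿cong (*-cong q^-2 s₂))
        (solve 3 (λ q y t → :- (q :^ 5 :* y :* (q :^ 4 :* y :^ 2 :* t)) := :- (q :^ 9 :* y :^ 3 :* t)) refl q y t)

    s-3m+1 : s (1 ℕ.+ 3 ℕ.* m) ≋ q * dil 3 c₁
    s-3m+1 = trans s₁ (trans (solve 3 (λ q y t → :- (q :* y :* t) := q :* :- (y :* t)) refl q y t)
      (*-congˡ (sym (trans (dil-neg 3 _) (-‿cong (trans (dil-* 3 x _) (*-congʳ dil₃x)))))))

    s-3m+2 : s (2 ℕ.+ 3 ℕ.* m) ≋ q * dil 3 c₂
    s-3m+2 = trans s₂ (trans (solve 3 (λ q y t → q :^ 4 :* y :^ 2 :* t := q :* (q :^ 3 :* (y :* (y :* t)))) refl q y t)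
      (*-congˡ (sym (trans (dil₃-q* _) (*-congˡ (trans (dil-* 3 x _) (*-cong dil₃x
        (trans (dil-* 3 x _) (*-congʳ dil₃x)))))))))

    s-3m+3 : s (3 ℕ.+ 3 ℕ.* m) ≋ dil 3 (dil 3 (s (suc m)))
    s-3m+3 = trans s₃ (sym (begin
      dil 3 (dil 3 (-ˢ (q * x * s m)))       ≈⟨ trans (dil-cong 3 (dil-neg 3 _)) (dil-neg 3 _) ⟩
      -ˢ dil 3 (dil 3 (q * x * s m))         ≈⟨ -‿cong (dil-cong 3 (trans (dil-* 3 (q * x) _)
                                                  (*-congʳ (trans (dil₃-q* x) (*-congˡ dil₃x))))) ⟩
      -ˢ dil 3 (q ^ 3 * y * dil 3 (s m))     ≈⟨ -‿cong (trans (dil-* 3 (q ^ 3 * y) _) (*-congʳ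
                                                  (trans (dil-q^* 3 3 y) (*-congˡ dil₃y)))) ⟩
      -ˢ (q ^ 9 * y ^ 3 * t)                 ∎))

    θ-3m+3 : ∀ c → θ (3 ℕ.* m) ≋ dil 3 (dil 3 (θ m)) + q * dil 3 c →
             ∃[ c′ ] θ (3 ℕ.+ 3 ℕ.* m) ≋ dil 3 (dil 3 (θ (suc m))) + q * dil 3 c′
    θ-3m+3 c p = c + const (+ 2) * (c₁ + c₂) , (begin
      θ (3 ℕ.* m) + const (+ 2) * s (1 ℕ.+ 3 ℕ.* m) + const (+ 2) * s (2 ℕ.+ 3 ℕ.* m) + const (+ 2) * s (3 ℕ.+ 3 ℕ.* m)
        ≈⟨ +-cong (+-cong (+-cong p (*-congˡ s-3m+1)) (*-congˡ s-3m+2)) (*-congˡ s-3m+3) ⟩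
      a + q * dil 3 c + const (+ 2) * (q * dil 3 c₁) + const (+ 2) * (q * dil 3 c₂) + const (+ 2) * b
        ≈⟨ solve 6 (λ q a c c₁ c₂ b → a :+ q :* c :+ con (+ 2) :* (q :* c₁) :+ con (+ 2) :* (q :* c₂) :+ con (+ 2) :* b
             := (a :+ con (+ 2) :* b) :+ q :* (c :+ con (+ 2) :* (c₁ :+ c₂))) refl q a (dil 3 c) (dil 3 c₁) (dil 3 c₂) b ⟩
      (a + const (+ 2) * b) + q * (dil 3 c + const (+ 2) * (dil 3 c₁ + dil 3 c₂))
        ≈⟨ +-cong dil-θ (*-congˡ dil-c) ⟨
      dil 3 (dil 3 (θ (suc m))) + q * dil 3 (c + const (+ 2) * (c₁ + c₂)) ∎)
      where
      a = dil 3 (dil 3 (θ m))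
      b = dil 3 (dil 3 (s (suc m)))
      dil-θ : dil 3 (dil 3 (θ m + const (+ 2) * s (suc m))) ≋ a + const (+ 2) * b
      dil-θ = trans (dil-cong 3 (trans (dil-+ 3 _ _) (+-congˡ (dil-const* 3 (+ 2) _))))
        (trans (dil-+ 3 _ _) (+-congˡ (dil-const* 3 (+ 2) _)))
      dil-c : dil 3 (c + const (+ 2) * (c₁ + c₂)) ≋ dil 3 c + const (+ 2) * (dil 3 c₁ + dil 3 c₂)
      dil-c = trans (dil-+ 3 _ _) (+-congˡ (trans (dil-const* 3 (+ 2) _) (*-congˡ (dil-+ 3 _ _))))

s-3m : ∀ m → s (3 ℕ.* m) ≋ dil 3 (dil 3 (s m))
s-3m zero    = sym (trans (dil-cong 3 (dil-one 3)) (dil-one 3))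
s-3m (suc m) = ≡.subst (λ k → s k ≋ dil 3 (dil 3 (s (suc m)))) (≡.sym (ℕₚ.*-suc 3 m)) (s-3m+3 m (s-3m m))

-- Squares of multiples of 3 are divisible by 9 and all other squares are 1 modulo 3. The series `c`
-- is left existential, because in the limit it is replaced by `C 1 G`.
θ-tri : ∀ m → ∃[ c ] θ (3 ℕ.* m) ≋ dil 3 (dil 3 (θ m)) + q * dil 3 c
θ-tri zero    = zeroˢ , (begin
  oneˢ                                          ≈⟨ solve 1 (λ q → :1 := :1 :+ q :* con (+ 0)) refl q ⟩
  oneˢ + q * zeroˢ                              ≈⟨ +-cong (trans (dil-cong 3 (dil-one 3)) (dil-one 3))
                                                   (*-congˡ (dil-const 3 (+ 0))) ⟨
  dil 3 (dil 3 oneˢ) + q * dil 3 zeroˢ          ∎)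
θ-tri (suc m) = ≡.subst (λ k → ∃[ c ] θ k ≋ dil 3 (dil 3 (θ (suc m))) + q * dil 3 c) (≡.sym (ℕₚ.*-suc 3 m))
  (θ-3m+3 m (s-3m m) (proj₁ (θ-tri m)) (proj₂ (θ-tri m)))

tri-zero : ∀ a b → dil 3 a + q * dil 3 b ≋ tri a b zeroˢ
tri-zero a b = trans (solve 3 (λ q a b → a :+ q :* b := a :+ q :* b :+ q :* (q :* con (+ 0))) refl q (dil 3 a) (dil 3 b))
  (+-congˡ (*-congˡ (*-congˡ (sym (dil-const 3 (+ 0))))))

θ-tri′ : ∀ m → θ (3 ℕ.* m) ≋ tri (dil 3 (θ m)) (proj₁ (θ-tri m)) zeroˢ
θ-tri′ m = trans (proj₂ (θ-tri m)) (tri-zero (dil 3 (θ m)) (proj₁ (θ-tri m)))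

C₀-G : C 0 G ≋ dil 3 G
C₀-G = ≈⇒≋ λ m → ≈-trans (C-≈ 0<3 (gauss (3 ℕ.* m)))
  (≈-trans (≋⇒≈ (trans (C-cong 0 (θ-tri′ m)) (C₀-tri (dil 3 (θ m)) (proj₁ (θ-tri m)) zeroˢ))) (dil-≈ 3 (≈-sym (gauss m))))

C₂-G : C 2 G ≋ zeroˢ
C₂-G = ≈⇒≋ λ m → ≈-trans (C-≈ 2<3 (gauss (3 ℕ.* m)))
  (≋⇒≈ (trans (C-cong 2 (θ-tri′ m)) (C₂-tri (dil 3 (θ m)) (proj₁ (θ-tri m)) zeroˢ)))

G-tri : G ≋ tri (dil 3 G) (C 1 G) zeroˢ
G-tri = trans (tri-C G) (+-cong (+-congʳ (dil-cong 3 C₀-G)) (*-congˡ (*-congˡ (dil-cong 3 C₂-G))))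

-- The norm of φ(-q) and the cubic relation

*-head-1 : ∀ {f g} → f 0 ≡ + 1 → g 0 ≡ + 1 → (f * g) 0 ≡ + 1
*-head-1 {f} {g} p r = ≡.trans (*-at-0 f g) (cong₂ ℤ._*_ p r)

^-head-1 : ∀ {f} k → f 0 ≡ + 1 → (f ^ k) 0 ≡ + 1
^-head-1 zero    p = ≡.refl
^-head-1 (suc k) p = *-head-1 p (^-head-1 k p)

dil₃E-head : dil 3 E 0 ≡ + 1
dil₃E-head = dil-head 3 E

G-head : G 0 ≡ + 1
G-head = *-head-1 (^-head-1 2 ≡.refl) ≡.refl

G₃ A : PS
G₃ = dil 3 G
A  = dil 3 G₃

E₆ : PS
E₆ = dil 2 (dil 3 E)

G₃-E : G₃ * E₆ ≋ dil 3 E ^ 2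
G₃-E = begin
  dil 3 G * dil 2 (dil 3 E)  ≈⟨ *-congˡ (dil₂-dil₃ E) ⟩
  dil 3 G * dil 3 (dil 2 E)  ≈⟨ dil-* 3 G (dil 2 E) ⟨
  dil 3 (G * dil 2 E)        ≈⟨ dil-cong 3 G-E ⟩
  dil 3 (E ^ 2)              ≈⟨ dil-^ 3 E 2 ⟩
  dil 3 E ^ 2                ∎

norm-G : norm G * G₃ ≋ G ^ 4
-- The factor `e₂ ^ 4` equals `norm e₂ * E₆`: `norm e₂` completes `norm G` to the norm of `G * e₂`,
-- that is of E², and `E₆` completes `G₃` to `e₃ ^ 2`.
norm-G = *-cancelˡ (e₂ ^ 4 * e₃ ^ 2) (*-head-1 (^-head-1 4 dil₂E-head) (^-head-1 2 dil₃E-head)) (begin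
  e₂ ^ 4 * e₃ ^ 2 * (norm G * G₃)
    ≈⟨ *-congʳ (*-congʳ norm-e₂) ⟨
  norm e₂ * E₆ * e₃ ^ 2 * (norm G * G₃)
    ≈⟨ solve 5 (λ a b c d e → a :* b :* c :^ 2 :* (d :* e) := (d :* a) :* (e :* b) :* c :^ 2) refl
         (norm e₂) E₆ e₃ (norm G) G₃ ⟩
  (norm G * norm e₂) * (G₃ * E₆) * e₃ ^ 2
    ≈⟨ *-congʳ (*-cong (trans (sym (norm-* G e₂)) (norm-cong G-E)) G₃-E) ⟩
  norm (E ^ 2) * e₃ ^ 2 * e₃ ^ 2
    ≈⟨ *-congʳ (*-congʳ (trans (norm-cong (solve 1 (λ e → e :^ 2 := e :* e) refl E)) (norm-* E E))) ⟩
  norm E * norm E * e₃ ^ 2 * e₃ ^ 2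
    ≈⟨ solve 2 (λ n e → n :* n :* e :^ 2 :* e :^ 2 := (n :* e) :^ 2 :* e :^ 2) refl (norm E) e₃ ⟩
  (norm E * e₃) ^ 2 * e₃ ^ 2
    ≈⟨ *-congʳ (^-cong 2 norm-E) ⟩
  (E ^ 4) ^ 2 * e₃ ^ 2
    ≈⟨ solve 2 (λ e f → (e :^ 4) :^ 2 :* f :^ 2 := (e :^ 2) :^ 4 :* f :^ 2) refl E e₃ ⟩
  (E ^ 2) ^ 4 * e₃ ^ 2
    ≈⟨ *-congʳ (^-cong 4 G-E) ⟨
  (G * e₂) ^ 4 * e₃ ^ 2
    ≈⟨ solve 3 (λ g a b → (g :* a) :^ 4 :* b :^ 2 := a :^ 4 :* b :^ 2 :* g :^ 4) refl G e₂ e₃ ⟩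
  e₂ ^ 4 * e₃ ^ 2 * G ^ 4 ∎)
  where
  e₂ = dil 2 E
  e₃ = dil 3 E
  norm-e₂ : norm e₂ * E₆ ≋ e₂ ^ 4
  norm-e₂ = begin
    norm e₂ * E₆                ≈⟨ *-congʳ (norm-dil₂ E) ⟩
    dil 2 (norm E) * dil 2 e₃   ≈⟨ dil-* 2 (norm E) e₃ ⟨
    dil 2 (norm E * e₃)         ≈⟨ dil-cong 2 norm-E ⟩
    dil 2 (E ^ 4)               ≈⟨ dil-^ 2 E 4 ⟩
    e₂ ^ 4                      ∎

-- Writing the second component as `G - A` eliminates it, leaving a relation between φ(-q), φ(-q³)
-- and φ(-q⁹) alone.
theta-cubic : (A ^ 3 + (G - A) ^ 3) * A ≋ G₃ ^ 4
theta-cubic = begin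
  (A ^ 3 + (G - A) ^ 3) * A          ≈⟨ *-congʳ (+-congˡ (^-cong 3 G-A)) ⟩
  (A ^ 3 + (q * dil 3 c) ^ 3) * A    ≈⟨ *-congʳ dil-norm-G ⟨
  dil 3 (norm G) * A                 ≈⟨ dil-* 3 (norm G) G₃ ⟨
  dil 3 (norm G * G₃)                ≈⟨ dil-cong 3 norm-G ⟩
  dil 3 (G ^ 4)                      ≈⟨ dil-^ 3 G 4 ⟩
  G₃ ^ 4                             ∎
  where
  c = C 1 G
  G-A : G - A ≋ q * dil 3 c
  G-A = trans (+-congʳ (trans G-tri (sym (tri-zero G₃ c))))
    (solve 3 (λ q a c → a :+ q :* c :- a := q :* c) refl q A (dil 3 c))
  dil-norm-G : dil 3 (norm G) ≋ A ^ 3 + (q * dil 3 c) ^ 3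
  dil-norm-G = begin
    dil 3 (norm G)
      ≈⟨ dil-cong 3 (trans (norm-cong G-tri) (trans (norm-tri G₃ c zeroˢ)
           (solve 3 (λ q a c → a :^ 3 :+ q :* c :^ 3 :+ q :* (q :* con (+ 0) :^ 3)
             :+ con (- + 3) :* (q :* (a :* (c :* con (+ 0)))) := a :^ 3 :+ q :* c :^ 3) refl q G₃ c))) ⟩
    dil 3 (G₃ ^ 3 + q * c ^ 3)
      ≈⟨ trans (dil-+ 3 _ _) (+-cong (dil-^ 3 G₃ 3) (trans (dil-* 3 q _) (*-cong (dil-q 3) (dil-^ 3 c 3)))) ⟩
    A ^ 3 + q ^ 3 * dil 3 c ^ 3
      ≈⟨ +-congˡ (^-* 3 q (dil 3 c)) ⟨
    A ^ 3 + (q * dil 3 c) ^ 3 ∎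

h k H : PS
h = G₃ * inv G
k = dil 3 (inv G) * G
H = dil 3 h

G-inverse : G * inv G ≋ oneˢ
G-inverse = inv-inverseʳ G G-head

hG : h * G ≋ G₃
hG = trans (*-assoc _ _ _) (trans (*-congˡ (trans (*-comm _ _) G-inverse)) (*-identityʳ _))

kh : k * h ≋ oneˢ
kh = begin
  dil 3 (inv G) * G * (G₃ * inv G)          ≈⟨ solve 4 (λ a b c d → a :* b :* (c :* d) := (b :* d) :* (c :* a)) refl
                                                 (dil 3 (inv G)) G G₃ (inv G) ⟩
  (G * inv G) * (dil 3 G * dil 3 (inv G))   ≈⟨ *-cong G-inverse (trans (sym (dil-* 3 G (inv G)))
                                                 (trans (dil-cong 3 G-inverse) (dil-one 3))) ⟩
  oneˢ * oneˢ                               ≈⟨ *-identityˡ oneˢ ⟩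
  oneˢ                                      ∎

h-head : h 0 ≡ + 1
h-head = *-head-1 (≡.trans (dil-head 3 G) G-head) ≡.refl

-- `theta-cubic` is homogeneous of degree 4. After substituting hG for `G₃` and HhG for `A`, the
-- factor G⁴h cancels, and in (Hh)³ + (1 - Hh)³ the cubes cancel too, leaving 1 - 3Hh + 3H²h².
h-cubic : h ^ 3 ≋ const (+ 3) * (H ^ 3 * h ^ 2) + const (- + 3) * (H ^ 2 * h) + H
h-cubic = *-cancelˡ (G ^ 4 * h) (*-head-1 (^-head-1 4 G-head) h-head) (begin
  G ^ 4 * h * h ^ 3
    ≈⟨ solve 2 (λ g h → g :^ 4 :* h :* h :^ 3 := (h :* g) :^ 4) refl G h ⟩
  (h * G) ^ 4
    ≈⟨ trans (^-cong 4 hG) (sym theta-cubic) ⟩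
  (A ^ 3 + (G - A) ^ 3) * A
    ≈⟨ *-cong (+-cong (^-cong 3 A≋) (^-cong 3 (+-congˡ (-‿cong A≋)))) A≋ ⟩
  ((H * (h * G)) ^ 3 + (G - H * (h * G)) ^ 3) * (H * (h * G))
    ≈⟨ solve 3 (λ g h H → ((H :* (h :* g)) :^ 3 :+ (g :- H :* (h :* g)) :^ 3) :* (H :* (h :* g))
         := g :^ 4 :* h :* (con (+ 3) :* (H :^ 3 :* h :^ 2) :+ con (- + 3) :* (H :^ 2 :* h) :+ H)) refl G h H ⟩
  G ^ 4 * h * (const (+ 3) * (H ^ 3 * h ^ 2) + const (- + 3) * (H ^ 2 * h) + H) ∎)
  where
  A≋ : A ≋ H * (h * G)
  A≋ = begin
    dil 3 G₃         ≈⟨ dil-cong 3 hG ⟨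
    dil 3 (h * G)    ≈⟨ dil-* 3 h G ⟩
    H * G₃           ≈⟨ *-congˡ hG ⟨
    H * (h * G)      ∎

X-h : X ≋ h ^ 4
X-h = *-cancelˡ D D-head (begin
  D * X                                        ≡⟨ cong (D *_) X-def ⟩
  D * ((e₂ ^ 4 * e₃ ^ 8) * inv D)              ≈⟨ solve 3 (λ d a b → d :* (a :* b) := a :* (d :* b)) refl
                                                    D (e₂ ^ 4 * e₃ ^ 8) (inv D) ⟩
  (e₂ ^ 4 * e₃ ^ 8) * (D * inv D)              ≈⟨ trans (*-congˡ (inv-inverseʳ D D-head)) (*-identityʳ _) ⟩
  e₂ ^ 4 * e₃ ^ 8                              ≈⟨ solve 2 (λ a b → a :^ 4 :* b :^ 8 := a :^ 4 :* (b :^ 2) :^ 4) refl e₂ e₃ ⟩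
  e₂ ^ 4 * (e₃ ^ 2) ^ 4                        ≈⟨ *-congˡ (^-cong 4 (trans (*-congʳ hG) G₃-E)) ⟨
  e₂ ^ 4 * (h * G * E₆) ^ 4                    ≈⟨ solve 4 (λ a h g b → a :^ 4 :* (h :* g :* b) :^ 4
                                                    := (g :* a) :^ 4 :* b :^ 4 :* h :^ 4) refl e₂ h G E₆ ⟩
  (G * e₂) ^ 4 * E₆ ^ 4 * h ^ 4                ≈⟨ *-congʳ (*-cong (^-cong 4 G-E) (^-cong 4 (dil-dil 2 3 E))) ⟩
  (E ^ 2) ^ 4 * dil 6 E ^ 4 * h ^ 4            ≈⟨ *-congʳ (*-congʳ (^-^ E 2 4)) ⟩
  D * h ^ 4                                    ∎)
  where
  e₂ = dil 2 E
  e₃ = dil 3 E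
  D : PS
  D = E ^ 8 * dil 6 E ^ 4
  D-head : D 0 ≡ + 1
  D-head = *-head-1 (^-head-1 8 ≡.refl) (^-head-1 4 (dil-head 6 E))
  X-def : X ≡ (e₂ ^ 4 * e₃ ^ 8) * inv D
  X-def rewrite *≡*ˢ (e₂ ^ 4 * e₃ ^ 8) (inv D) | *≡*ˢ (e₂ ^ 4) (e₃ ^ 8) | *≡*ˢ (E ^ 8) (dil 6 E ^ 4)
    | ^≡^ˢ e₂ 4 | ^≡^ˢ e₃ 8 | ^≡^ˢ E 8 | ^≡^ˢ (dil 6 E) 4 = ≡.refl

-- The recurrence for U of the powers of h

-- t n = U (hⁿ⁻²): k is the inverse of h.
t : ℕ → PS
t n = C 0 (k ^ 2 * h ^ n)

-- Up to a series in q³, h⁻² is G². As G has components only in residues 0 and 1, a product of two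
-- of them lands in residue 0 only as the square of the first.
t-0 : t 0 ≋ h ^ 2
t-0 = begin
  C 0 (k ^ 2 * oneˢ)                ≈⟨ C-cong 0 (solve 2 (λ v g → (v :* g) :^ 2 :* :1 := v :^ 2 :* (g :* g)) refl
                                         (dil 3 (inv G)) G) ⟩
  C 0 (dil 3 (inv G) ^ 2 * (G * G)) ≈⟨ C-cong 0 (*-congʳ (dil-^ 3 (inv G) 2)) ⟨
  C 0 (dil 3 (inv G ^ 2) * (G * G)) ≈⟨ C-dil* 0<3 (inv G ^ 2) (G * G) ⟩
  inv G ^ 2 * C 0 (G * G)           ≈⟨ *-congˡ (trans (C-cong 0 (*-congʳ G-tri)) (C₀-tri* G₃ (C 1 G) zeroˢ G)) ⟩
  inv G ^ 2 * (G₃ * C 0 G + q * (C 1 G * C 2 G) + q * (zeroˢ * C 1 G))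
    ≈⟨ *-congˡ (+-congʳ (+-cong (*-congˡ C₀-G) (*-congˡ (*-congˡ C₂-G)))) ⟩
  inv G ^ 2 * (G₃ * G₃ + q * (C 1 G * zeroˢ) + q * (zeroˢ * C 1 G))
    ≈⟨ solve 4 (λ q v g c → v :^ 2 :* (g :* g :+ q :* (c :* con (+ 0)) :+ q :* (con (+ 0) :* c))
         := (g :* v) :^ 2) refl q (inv G) G₃ (C 1 G) ⟩
  h ^ 2 ∎

t-1 : t 1 ≋ h
t-1 = begin
  C 0 (k ^ 2 * h ^ 1)      ≈⟨ C-cong 0 (trans (solve 2 (λ k h → k :^ 2 :* h :^ 1 := k :* (k :* h)) refl k h)
                                (trans (*-congˡ kh) (*-identityʳ k))) ⟩
  C 0 (dil 3 (inv G) * G)  ≈⟨ C-dil* 0<3 (inv G) G ⟩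
  inv G * C 0 G            ≈⟨ *-congˡ C₀-G ⟩
  inv G * G₃               ≈⟨ *-comm _ _ ⟩
  h                        ∎

k²h^2+n : ∀ n → k ^ 2 * h ^ (2 ℕ.+ n) ≋ h ^ n
k²h^2+n n = begin
  k ^ 2 * (h * (h * h ^ n))  ≈⟨ solve 3 (λ k h x → k :^ 2 :* (h :* (h :* x)) := (k :* h) :^ 2 :* x) refl k h (h ^ n) ⟩
  (k * h) ^ 2 * h ^ n        ≈⟨ *-congʳ (^-cong 2 kh) ⟩
  oneˢ ^ 2 * h ^ n           ≈⟨ solve 1 (λ x → :1 :^ 2 :* x := x) refl (h ^ n) ⟩
  h ^ n                      ∎

t-2 : t 2 ≋ oneˢ
t-2 = trans (C-cong 0 (k²h^2+n 0)) C₀-one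

t-rec : ∀ n → t (3 ℕ.+ n) ≋ const (+ 3) * (h ^ 3 * t (2 ℕ.+ n)) + const (- + 3) * (h ^ 2 * t (1 ℕ.+ n)) + h * t n
t-rec n = begin
  C 0 (k ^ 2 * h ^ (3 ℕ.+ n))
    ≈⟨ C-cong 0 (trans (solve 3 (λ k h x → k :^ 2 :* (h :* (h :* (h :* x))) := h :^ 3 :* (k :^ 2 :* x)) refl k h (h ^ n))
         (trans (*-congʳ h-cubic)
           (solve 4 (λ k h H x → (con (+ 3) :* (H :^ 3 :* h :^ 2) :+ con (- + 3) :* (H :^ 2 :* h) :+ H) :* (k :^ 2 :* x)
             := con (+ 3) :* (H :^ 3 :* (k :^ 2 :* (h :* (h :* x))))
               :+ con (- + 3) :* (H :^ 2 :* (k :^ 2 :* (h :* x))) :+ H :* (k :^ 2 :* x))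
             refl k h H (h ^ n)))) ⟩
  C 0 (const (+ 3) * (H ^ 3 * (k ^ 2 * h ^ (2 ℕ.+ n))) + const (- + 3) * (H ^ 2 * (k ^ 2 * h ^ (1 ℕ.+ n))) + H * (k ^ 2 * h ^ n))
    ≈⟨ trans (C-+ 0 _ _) (+-cong (trans (C-+ 0 _ _) (+-cong
         (trans (C-const* 0 (+ 3) _) (*-congˡ (C-H^ 3 _)))
         (trans (C-const* 0 (- + 3) _) (*-congˡ (C-H^ 2 _)))))
         (C-dil* 0<3 h _)) ⟩
  const (+ 3) * (h ^ 3 * t (2 ℕ.+ n)) + const (- + 3) * (h ^ 2 * t (1 ℕ.+ n)) + h * t n ∎
  where
  C-H^ : ∀ j f → C 0 (H ^ j * f) ≋ h ^ j * C 0 f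
  C-H^ j f = trans (C-cong 0 (*-congʳ (sym (dil-^ 3 h j)))) (C-dil* 0<3 (h ^ j) f)

-- The exponents of h in each `t n` lie in a single class modulo 4, so a starting exponent and a
-- list of coefficients of powers of h⁴ describe it.
poly : ℕ → List ℤ → PS
poly e cs = h ^ e * horner cs
  where
  horner : List ℤ → PS
  horner []       = zeroˢ
  horner (c ∷ cs) = const c + h ^ 4 * horner cs

-- Built in the same Horner shape as `poly`, so that its value at `h` matches `poly e cs` in the
-- solver goals.
:poly : PS-Solver.Polynomial 1 → ℕ → List ℤ → PS-Solver.Polynomial 1
:poly x e cs = x :^ e :* horner cs
  where
  horner : List ℤ → PS-Solver.Polynomial 1
  horner []       = con (+ 0)
  horner (c ∷ cs) = con c :+ x :^ 4 :* horner cs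

t-step : ∀ n {a b c} → t n ≋ a → t (1 ℕ.+ n) ≋ b → t (2 ℕ.+ n) ≋ c →
         t (3 ℕ.+ n) ≋ const (+ 3) * (h ^ 3 * c) + const (- + 3) * (h ^ 2 * b) + h * a
t-step n p r s = trans (t-rec n) (+-cong (+-cong (*-congˡ (*-congˡ s)) (*-congˡ (*-congˡ r))) (*-congˡ p))

:step : (x a b c : PS-Solver.Polynomial 1) → PS-Solver.Polynomial 1
:step x a b c = con (+ 3) :* (x :^ 3 :* c) :+ con (- + 3) :* (x :^ 2 :* b) :+ x :* a

-- The lists up to `cs₁₄` come from iterating the recurrence, each being confirmed by the solver in
-- the `t` lemma of the same index. The theorem reads off `cs₆`, `cs₁₀` and `cs₁₄`.
cs₃ : List ℤ
cs₃ = + 1 ∷ []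

cs₄ : List ℤ
cs₄ = - + 2 ∷ + 3 ∷ []

cs₅ : List ℤ
cs₅ = + 1 ∷ - + 9 ∷ + 9 ∷ []

cs₆ : List ℤ
cs₆ = + 10 ∷ - + 36 ∷ + 27 ∷ []

cs₇ : List ℤ
cs₇ = - + 5 ∷ + 60 ∷ - + 135 ∷ + 81 ∷ []

cs₈ : List ℤ
cs₈ = + 1 ∷ - + 54 ∷ + 297 ∷ - + 486 ∷ + 243 ∷ []

cs₉ : List ℤ
cs₉ = + 28 ∷ - + 378 ∷ + 1323 ∷ - + 1701 ∷ + 729 ∷ []

cs₁₀ : List ℤ
cs₁₀ = - + 8 ∷ + 306 ∷ - + 2160 ∷ + 5508 ∷ - + 5832 ∷ + 2187 ∷ []

cs₁₁ : List ℤ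
cs₁₁ = + 1 ∷ - + 162 ∷ + 2349 ∷ - + 10935 ∷ + 21870 ∷ - + 19683 ∷ + 6561 ∷ []

cs₁₂ : List ℤ
cs₁₂ = + 55 ∷ - + 1782 ∷ + 14850 ∷ - + 51030 ∷ + 83835 ∷ - + 65610 ∷ + 19683 ∷ []

cs₁₃ : List ℤ
cs₁₃ = - + 11 ∷ + 957 ∷ - + 14553 ∷ + 82863 ∷ - + 224532 ∷ + 312741 ∷ - + 216513 ∷ + 59049 ∷ []

cs₁₄ : List ℤ
cs₁₄ = + 1 ∷ - + 360 ∷ + 10566 ∷ - + 99144 ∷ + 423549 ∷ - + 944784 ∷ + 1141614 ∷ - + 708588 ∷ + 177147 ∷ []

t-3 : t 3 ≋ poly 3 cs₃
t-3 = trans (t-step 0 t-0 t-1 t-2) (solve 1 (λ x →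
  :step x (x :^ 2) x :1 := :poly x 3 cs₃) refl h)

t-4 : t 4 ≋ poly 2 cs₄
t-4 = trans (t-step 1 t-1 t-2 t-3) (solve 1 (λ x →
  :step x x :1 (:poly x 3 cs₃) := :poly x 2 cs₄) refl h)

t-5 : t 5 ≋ poly 1 cs₅
t-5 = trans (t-step 2 t-2 t-3 t-4) (solve 1 (λ x →
  :step x :1 (:poly x 3 cs₃) (:poly x 2 cs₄) := :poly x 1 cs₅) refl h)

t-6 : t 6 ≋ poly 4 cs₆
t-6 = trans (t-step 3 t-3 t-4 t-5) (solve 1 (λ x →
  :step x (:poly x 3 cs₃) (:poly x 2 cs₄) (:poly x 1 cs₅) := :poly x 4 cs₆) refl h)

t-7 : t 7 ≋ poly 3 cs₇
t-7 = trans (t-step 4 t-4 t-5 t-6) (solve 1 (λ x →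
  :step x (:poly x 2 cs₄) (:poly x 1 cs₅) (:poly x 4 cs₆) := :poly x 3 cs₇) refl h)

t-8 : t 8 ≋ poly 2 cs₈
t-8 = trans (t-step 5 t-5 t-6 t-7) (solve 1 (λ x →
  :step x (:poly x 1 cs₅) (:poly x 4 cs₆) (:poly x 3 cs₇) := :poly x 2 cs₈) refl h)

t-9 : t 9 ≋ poly 5 cs₉
t-9 = trans (t-step 6 t-6 t-7 t-8) (solve 1 (λ x →
  :step x (:poly x 4 cs₆) (:poly x 3 cs₇) (:poly x 2 cs₈) := :poly x 5 cs₉) refl h)

t-10 : t 10 ≋ poly 4 cs₁₀
t-10 = trans (t-step 7 t-7 t-8 t-9) (solve 1 (λ x →
  :step x (:poly x 3 cs₇) (:poly x 2 cs₈) (:poly x 5 cs₉) := :poly x 4 cs₁₀) refl h)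

t-11 : t 11 ≋ poly 3 cs₁₁
t-11 = trans (t-step 8 t-8 t-9 t-10) (solve 1 (λ x →
  :step x (:poly x 2 cs₈) (:poly x 5 cs₉) (:poly x 4 cs₁₀) := :poly x 3 cs₁₁) refl h)

t-12 : t 12 ≋ poly 6 cs₁₂
t-12 = trans (t-step 9 t-9 t-10 t-11) (solve 1 (λ x →
  :step x (:poly x 5 cs₉) (:poly x 4 cs₁₀) (:poly x 3 cs₁₁) := :poly x 6 cs₁₂) refl h)

t-13 : t 13 ≋ poly 5 cs₁₃
t-13 = trans (t-step 10 t-10 t-11 t-12) (solve 1 (λ x →
  :step x (:poly x 4 cs₁₀) (:poly x 3 cs₁₁) (:poly x 6 cs₁₂) := :poly x 5 cs₁₃) refl h)

t-14 : t 14 ≋ poly 4 cs₁₄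
t-14 = trans (t-step 11 t-11 t-12 t-13) (solve 1 (λ x →
  :step x (:poly x 3 cs₁₁) (:poly x 6 cs₁₂) (:poly x 5 cs₁₃) := :poly x 4 cs₁₄) refl h)

-- Return from h to X

U-X^ : ∀ j → U (X ^ˢ j) ≈ˢ t (2 ℕ.+ 4 ℕ.* j)
U-X^ j n = ≡.trans (cong (λ f → f (3 ℕ.* n)) (≡.sym (^≡^ˢ X j)))
  (at (trans (^-cong j X-h) (trans (^-^ h 4 j) (sym (k²h^2+n (4 ℕ.* j))))) (3 ℕ.* n))

infixl 6 _⊞_
-- Crosses from the transparent sum of the theorem to the abstract one on which the solver works.
_⊞_ : ∀ {f f′ g g′} → f ≋ f′ → g ≋ g′ → f +ˢ g ≋ f′ + g′
_⊞_ {f′ = f′} {g′ = g′} p r = mk λ n → ≡.trans (cong₂ ℤ._+_ (at p n) (at r n)) (≡.sym (+-at f′ g′ n))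

·X : ∀ c → c ·ˢ X ≋ const c * h ^ 4
·X c = mk λ n → ≡.trans (cong (c ℤ.*_) (at X-h n)) (≡.sym (const-*-at c (h ^ 4) n))

·X^ : ∀ c j → c ·ˢ X ^ˢ j ≋ const c * (h ^ 4) ^ j
·X^ c j = mk λ n → ≡.trans
  (cong (c ℤ.*_) (≡.trans (cong (λ f → f n) (≡.sym (^≡^ˢ X j))) (at (^-cong j X-h) n)))
  (≡.sym (const-*-at c ((h ^ 4) ^ j) n))

U-X : U X ≈ˢ t 6
U-X n = at (trans X-h (sym (k²h^2+n 4))) (3 ℕ.* n)

theorem2p3 : (U X ≈ˢ (+ 10) ·ˢ X +ˢ (- (+ 36)) ·ˢ X ^ˢ 2 +ˢ (+ 27) ·ˢ X ^ˢ 3)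
    × (U (X ^ˢ 2) ≈ˢ (- (+ 8)) ·ˢ X +ˢ (+ 306) ·ˢ X ^ˢ 2 +ˢ (- (+ 2160)) ·ˢ X ^ˢ 3
    +ˢ (+ 5508) ·ˢ X ^ˢ 4 +ˢ (- (+ 5832)) ·ˢ X ^ˢ 5 +ˢ (+ 2187) ·ˢ X ^ˢ 6)
    × (U (X ^ˢ 3) ≈ˢ (+ 1) ·ˢ X +ˢ (- (+ 360)) ·ˢ X ^ˢ 2 +ˢ (+ 10566) ·ˢ X ^ˢ 3
    +ˢ (- (+ 99144)) ·ˢ X ^ˢ 4 +ˢ (+ 423549) ·ˢ X ^ˢ 5 +ˢ (- (+ 944784)) ·ˢ X ^ˢ 6
    +ˢ (+ 1141614) ·ˢ X ^ˢ 7 +ˢ (- (+ 708588)) ·ˢ X ^ˢ 8 +ˢ (+ 177147) ·ˢ X ^ˢ 9)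
theorem2p3 = at (trans (mk U-X) (trans t-6 (trans
    (solve 1 (λ x → :poly x 4 cs₆ :=
      con (+ 10) :* x :^ 4 :+ con (- + 36) :* (x :^ 4) :^ 2 :+ con (+ 27) :* (x :^ 4) :^ 3) refl h)
    (sym (·X (+ 10) ⊞ ·X^ (- + 36) 2 ⊞ ·X^ (+ 27) 3)))))
  , at (trans (mk (U-X^ 2)) (trans t-10 (trans
    (solve 1 (λ x → :poly x 4 cs₁₀ :=
      con (- + 8) :* x :^ 4 :+ con (+ 306) :* (x :^ 4) :^ 2 :+ con (- + 2160) :* (x :^ 4) :^ 3
      :+ con (+ 5508) :* (x :^ 4) :^ 4 :+ con (- + 5832) :* (x :^ 4) :^ 5 :+ con (+ 2187) :* (x :^ 4) :^ 6) refl h)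
    (sym (·X (- + 8) ⊞ ·X^ (+ 306) 2 ⊞ ·X^ (- + 2160) 3
      ⊞ ·X^ (+ 5508) 4 ⊞ ·X^ (- + 5832) 5 ⊞ ·X^ (+ 2187) 6)))))
  , at (trans (mk (U-X^ 3)) (trans t-14 (trans
    (solve 1 (λ x → :poly x 4 cs₁₄ :=
      con (+ 1) :* x :^ 4 :+ con (- + 360) :* (x :^ 4) :^ 2 :+ con (+ 10566) :* (x :^ 4) :^ 3
      :+ con (- + 99144) :* (x :^ 4) :^ 4 :+ con (+ 423549) :* (x :^ 4) :^ 5 :+ con (- + 944784) :* (x :^ 4) :^ 6
      :+ con (+ 1141614) :* (x :^ 4) :^ 7 :+ con (- + 708588) :* (x :^ 4) :^ 8 :+ con (+ 177147) :* (x :^ 4) :^ 9) refl h)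
    (sym (·X (+ 1) ⊞ ·X^ (- + 360) 2 ⊞ ·X^ (+ 10566) 3
      ⊞ ·X^ (- + 99144) 4 ⊞ ·X^ (+ 423549) 5 ⊞ ·X^ (- + 944784) 6
      ⊞ ·X^ (+ 1141614) 7 ⊞ ·X^ (- + 708588) 8 ⊞ ·X^ (+ 177147) 9)))))
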